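{- Let $G$ be a directed graph. Then $G$ has a monomorphic decomposition into finitely many blocks if and only if $G$ is a lexicographical sum $\sum_{i\in D}G_i$ of a family of directed graphs $G_i$ indexed by a finite directed graph $D$, each $G_i$ being of one of six kinds: an oriented acyclic graph, a clique, an independent set, a chain, a reflexive clique, or an antichain. Moreover, if $G$ decomposes into such a sum with all $V(G_i)$ non-empty and if $D$ contains no $2$-element autonomous subset, then the infinite monomorphic components of $G$ are exactly the infinite sets $V(G_i)$.
   Context: A directed graph is $G=(V(G),\rho)$ with $\rho\subseteq V(G)^2$ (loops allowed). The six kinds: oriented acyclic graph = strict linear order (irreflexive, each pair of distinct vertices joined by exactly one arc, no directed cycle); clique: $\rho$ = all pairs of distinct vertices; independent set: $\rho=\emptyset$; chain: reflexive linear order; reflexive clique: $\rho=V^2$; antichain: $\rho$ = the diagonal. Lexicographical sum $\sum_{i\in D}G_i$ (vertex sets pairwise disjoint): vertex set $\bigcup_i V(G_i)$; for $x,y\in V(G_i)$, $(x,y)$ is an arc iff it is an arc of $G_i$; for $x\in V(G_i)$, $y\in V(G_j)$, $i\ne j$, $(x,y)$ is an arc iff $(i,j)$ is an arc of $D$. A subset $A$ of vertices is autonomous if for all $x,x'\in A$ and $y\notin A$: $(x,y)$ arc iff $(x',y)$ arc, and $(y,x)$ arc iff $(y,x')$ arc. A monomorphic decomposition of a structure on $E$ is a partition of $E$ such that for every $n$, the induced substructures on any two $n$-element subsets $A,A'$ are isomorphic whenever $|A\cap B|=|A'\cap B|$ for every block $B$. A monomorphic part is a subset $B$ such that for every $n$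 and all $n$-element $A,A'$ with $A\setminus B=A'\setminus B$ the induced substructures on $A,A'$ are isomorphic; the monomorphic components are the maximal monomorphic parts (they form a monomorphic decomposition). -}

module Defs where

open import Level using (0ℓ)
open import Data.Nat using (ℕ; zero; suc; _+_)
open import Data.Fin using (Fin; zero; suc; _≟_)
open import Data.Product using (Σ; ∃; _×_; _,_)
open import Data.Sum using (_⊎_)
open import Data.Empty using (⊥)
open import Relation.Nullary using (¬_; yes; no)
open import Relation.Binary.PropositionalEquality using (_≡_; _≢_)
open import Function.Bundles using (_⇔_; _↔_; Inverse)
open import Function.Definitions using (Injective)

record Digraph : Set₁ where
  field
    V   : Set
    arc : V → V → Set
open Digraph public

FinDigraph : ℕ → Set₁
FinDigraph m = Fin m → Fin m → Set

Subset : Set → Set₁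
Subset X = X → Set

Finite : {V : Set} → Subset V → Set
Finite {V} X = Σ ℕ λ n → Σ (Fin n → V) λ f → ∀ v → X v → Σ (Fin n) λ i → f i ≡ v

Infinite : {V : Set} → Subset V → Set
Infinite X = ¬ Finite X

-- n-element subsets are given by injective enumerations a : Fin n → V.

_∈Img_ : {V : Set} {n : ℕ} → V → (Fin n → V) → Set
v ∈Img a = ∃ λ i → a i ≡ v

InducedIso : (G : Digraph) {n : ℕ} → (Fin n → V G) → (Fin n → V G) → Set
InducedIso G {n} a a' =
  Σ (Fin n ↔ Fin n) λ σ →
    ∀ i j → arc G (a i) (a j) ⇔ arc G (a' (Inverse.to σ i)) (a' (Inverse.to σ j))

-- Monomorphic decomposition (partition given by block labels b : V → Fin k)

-- |A ∩ B_j| where A = image of a and B_j = b⁻¹(j)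
countIn : {n k : ℕ} → (Fin n → Fin k) → Fin k → ℕ
countIn {zero}  f j = 0
countIn {suc n} f j with f zero ≟ j
... | yes _ = suc (countIn (λ i → f (suc i)) j)
... | no  _ = countIn (λ i → f (suc i)) j

IsMonomorphicDecomposition : (G : Digraph) {k : ℕ} → (V G → Fin k) → Set
IsMonomorphicDecomposition G {k} b =
  (∀ j → ∃ λ v → b v ≡ j) ×
  (∀ (n : ℕ) (a a' : Fin n → V G) → Injective _≡_ _≡_ a → Injective _≡_ _≡_ a' →
     (∀ j → countIn (λ i → b (a i)) j ≡ countIn (λ i → b (a' i)) j) →
     InducedIso G a a')

IsMonomorphicPart : (G : Digraph) → Subset (V G) → Set
IsMonomorphicPart G B =
  ∀ (n : ℕ) (a a' : Fin n → V G) → Injective _≡_ _≡_ a → Injective _≡_ _≡_ a' →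
    (∀ v → (v ∈Img a × ¬ B v) ⇔ (v ∈Img a' × ¬ B v)) →
    InducedIso G a a'

IsMonomorphicComponent : (G : Digraph) → Subset (V G) → Set₁
IsMonomorphicComponent G B =
  IsMonomorphicPart G B ×
  (∀ C → IsMonomorphicPart G C → (∀ v → B v → C v) → ∀ v → C v → B v)

module _ (G : Digraph) (S : Subset (V G)) where
  private
    R = arc G

  -- strict linear order: irreflexive, exactly one arc between distinct
  -- vertices, and transitive (= no directed cycle, for tournaments)
  IsOrientedAcyclic : Set
  IsOrientedAcyclic =
    (∀ x → S x → ¬ R x x) ×
    (∀ x y → S x → S y → x ≢ y → (R x y ⊎ R y x) × ¬ (R x y × R y x)) ×
    (∀ x y z → S x → S y → S z → R x y → R y z → R x z)

  IsClique : Set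
  IsClique = ∀ x y → S x → S y → R x y ⇔ (x ≢ y)

  IsIndependent : Set
  IsIndependent = ∀ x y → S x → S y → ¬ R x y

  IsChain : Set
  IsChain =
    (∀ x → S x → R x x) ×
    (∀ x y → S x → S y → R x y → R y x → x ≡ y) ×
    (∀ x y z → S x → S y → S z → R x y → R y z → R x z) ×
    (∀ x y → S x → S y → R x y ⊎ R y x)

  IsReflexiveClique : Set
  IsReflexiveClique = ∀ x y → S x → S y → R x y

  IsAntichain : Set
  IsAntichain = ∀ x y → S x → S y → R x y ⇔ (x ≡ y)

  OfSixKinds : Set
  OfSixKinds = IsOrientedAcyclic ⊎ IsClique ⊎ IsIndependent ⊎
               IsChain ⊎ IsReflexiveClique ⊎ IsAntichain

fiber : {V : Set} {m : ℕ} → (V → Fin m) → Fin m → Subset V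
fiber p i v = p v ≡ i

-- G = Σ_{i ∈ D} G_i where V(G_i) = p⁻¹(i) (G_i the induced subgraph on it,
-- so arcs inside a block are those of G_i), and arcs between different
-- blocks are determined by D.
IsLexSum : (G : Digraph) {m : ℕ} → FinDigraph m → (V G → Fin m) → Set
IsLexSum G D p = ∀ x y → p x ≢ p y → arc G x y ⇔ D (p x) (p y)

IsLexSumOfSixKinds : Digraph → Set₁
IsLexSumOfSixKinds G =
  Σ ℕ λ m → Σ (FinDigraph m) λ D → Σ (V G → Fin m) λ p →
    IsLexSum G D p × (∀ i → OfSixKinds G (fiber p i))

IsAutonomous : {m : ℕ} → FinDigraph m → Subset (Fin m) → Set
IsAutonomous {m} D A =
  ∀ x x' y → A x → A x' → ¬ A y → (D x y ⇔ D x' y) × (D y x ⇔ D y x')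

NoTwoElementAutonomous : {m : ℕ} → FinDigraph m → Set
NoTwoElementAutonomous D =
  ∀ i j → i ≢ j → ¬ IsAutonomous D (λ x → (x ≡ i) ⊎ (x ≡ j))

{-# OPTIONS --safe #-}
module Submission where

-- For an infinite monomorphic part B, let its hull add to B every vertex y with
-- x ⟶ y ⟶ x' for some x, x' ∈ B, where ⟶ is the strict arc relation (an arc whose
-- reverse is absent).  Exchanging vertices of B in tuples of at most four vertices and
-- observing that having a source (or a sink) is an isomorphism invariant, one finds
-- that the hull is autonomous and of one of the six kinds; B alone need not be
-- autonomous, e.g. a linear order minus a point.  The finitely many hulls of the
-- infinite blocks, with the singletons of the finite blocks, cover the graph, and since
-- T ∖ S is autonomous when S ⊈ T, they can be made disjoint, giving a lexicographical
-- sum.  Conversely, in a lexicographical sum, two finite vertex sets with the same block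
-- counts are matched by repeatedly removing a least vertex of a common block.  Finally,
-- an autonomous set of one of the six kinds that meets two fibers yields a two-element
-- autonomous subset of D (in the linear case, the two lowest indices it meets), so an
-- infinite monomorphic part lies within one fiber.

open import Defs
open import Level using (0ℓ)
open import Axiom.ExcludedMiddle using (ExcludedMiddle)
open import Data.Empty using (⊥; ⊥-elim)
open import Data.Nat using (ℕ; zero; suc; _+_)
open import Data.Fin using (Fin; zero; suc; _≟_; punchIn; punchOut; splitAt; _↑ˡ_; _↑ʳ_)
open import Data.Product using (Σ; ∃; _×_; _,_; proj₁; proj₂)
open import Data.Sum using (_⊎_; inj₁; inj₂; [_,_]′)
open import Data.Unit using (⊤; tt)
open import Data.Nat.Properties using (+-0-commutativeMonoid; +-cancelˡ-≡)
open import Data.Fin.Properties using (punchIn-punchOut; punchIn-injective; punchInᵢ≢i; splitAt-↑ˡ; splitAt-↑ʳ)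
open import Data.Fin.Permutation as Perm using (Permutation; _⟨$⟩ʳ_; insert; insert-punchIn)
import Data.Vec.Functional as VF
open import Algebra.Properties.CommutativeMonoid.Sum +-0-commutativeMonoid using (sum; sum-remove; sum-cong-≗)
open import Function.Definitions using (Injective)
open import Data.Vec using (Vec; []; _∷_; _++_; lookup)
open import Data.Vec.Relation.Unary.All using (All; []; _∷_)
open import Data.Vec.Relation.Unary.AllPairs using ([]; _∷_)
open import Data.Vec.Relation.Unary.Unique.Propositional using (Unique)
open import Data.Vec.Relation.Unary.Unique.Propositional.Properties using (lookup-injective)
open import Function.Base using (_∘_; flip)
open import Function.Bundles using (_⇔_; mk⇔; Equivalence; Inverse; Injection)
open import Function.Construct.Composition using (_⇔-∘_)
open import Function.Construct.Identity using (⇔-id)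
open import Function.Construct.Symmetry using (⇔-sym)
open import Function.Properties.Inverse using (↔⇒↣)
open import Relation.Nullary using (¬_; Dec; yes; no)
open import Relation.Nullary.Decidable using (decidable-stable)
open import Relation.Binary.PropositionalEquality using (_≡_; _≢_; refl; sym; trans; cong; cong₂; subst; ≢-sym)

open Equivalence using () renaming (to to ⇒; from to ⇐)

-- The six kinds, separated into a shape and a loop condition; good sets.

module Kinds (em : ExcludedMiddle 0ℓ) (G : Digraph) where

  infix 4 _⟶_

  _⟶_ : V G → V G → Set
  x ⟶ y = arc G x y × ¬ arc G y x

  ⟶⇒≢ : ∀ {x y} → x ⟶ y → x ≢ y
  ⟶⇒≢ (xy , ¬yx) refl = ¬yx xy

  ⟶-asym : ∀ {x y} → x ⟶ y → ¬ (y ⟶ x)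
  ⟶-asym (xy , _) (_ , ¬xy) = ¬xy xy

  Comparable : V G → V G → Set
  Comparable x y = x ⟶ y ⊎ y ⟶ x

  -- Loops are split off: the three shapes in `Homogeneous` ignore them, and crossed with the two
  -- cases of `LoopUniform` they give the six kinds. Since `IsStrictOrder` speaks of `⟶`, it covers
  -- chains and oriented acyclic graphs alike.
  IsStrictOrder IsComplete IsEmpty Homogeneous LoopUniform : Subset (V G) → Set
  IsStrictOrder S =
    (∀ x y → S x → S y → x ≢ y → Comparable x y) ×
    (∀ x y z → S x → S y → S z → x ⟶ y → y ⟶ z → x ⟶ z)
  IsComplete S = ∀ x y → S x → S y → x ≢ y → arc G x y
  IsEmpty S = ∀ x y → S x → S y → x ≢ y → ¬ arc G x y
  Homogeneous S = IsStrictOrder S ⊎ IsComplete S ⊎ IsEmpty S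
  LoopUniform S = (∀ x → S x → arc G x x) ⊎ (∀ x → S x → ¬ arc G x x)

  sixKinds⇒homogeneous : ∀ {S} → OfSixKinds G S → Homogeneous S × LoopUniform S
  sixKinds⇒homogeneous (inj₁ (irr , tot , tr)) =
    inj₁ ((λ x y Sx Sy x≢y → let (c , ¬both) = tot x y Sx Sy x≢y in
             [ (λ xy → inj₁ (xy , λ yx → ¬both (xy , yx)))
             , (λ yx → inj₂ (yx , λ xy → ¬both (xy , yx))) ]′ c) ,
          λ x y z Sx Sy Sz (xy , ¬yx) (yz , _) →
            tr x y z Sx Sy Sz xy yz , λ zx → ¬yx (tr y z x Sy Sz Sx yz zx)) ,
    inj₂ irr
  sixKinds⇒homogeneous (inj₂ (inj₁ cl)) =
    inj₂ (inj₁ λ x y Sx Sy → ⇐ (cl x y Sx Sy)) ,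
    inj₂ λ x Sx xx → ⇒ (cl x x Sx Sx) xx refl
  sixKinds⇒homogeneous (inj₂ (inj₂ (inj₁ ind))) =
    inj₂ (inj₂ λ x y Sx Sy _ → ind x y Sx Sy) , inj₂ λ x Sx → ind x x Sx Sx
  sixKinds⇒homogeneous (inj₂ (inj₂ (inj₂ (inj₁ (rfl , anti , tr , tot))))) =
    inj₁ ((λ x y Sx Sy x≢y →
             [ (λ xy → inj₁ (xy , λ yx → x≢y (anti x y Sx Sy xy yx)))
             , (λ yx → inj₂ (yx , λ xy → x≢y (anti x y Sx Sy xy yx))) ]′ (tot x y Sx Sy)) ,
          λ x y z Sx Sy Sz (xy , ¬yx) (yz , _) →
            tr x y z Sx Sy Sz xy yz , λ zx → ¬yx (tr y z x Sy Sz Sx yz zx)) ,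
    inj₁ rfl
  sixKinds⇒homogeneous (inj₂ (inj₂ (inj₂ (inj₂ (inj₁ rc))))) =
    inj₂ (inj₁ λ x y Sx Sy _ → rc x y Sx Sy) , inj₁ λ x Sx → rc x x Sx Sx
  sixKinds⇒homogeneous (inj₂ (inj₂ (inj₂ (inj₂ (inj₂ ac))))) =
    inj₂ (inj₂ λ x y Sx Sy x≢y xy → x≢y (⇒ (ac x y Sx Sy) xy)) ,
    inj₁ λ x Sx → ⇐ (ac x x Sx Sx) refl

  homogeneous⇒sixKinds : ∀ {S} → Homogeneous S → LoopUniform S → OfSixKinds G S
  homogeneous⇒sixKinds {S} (inj₁ (tot , tr)) (inj₁ loops) =
    inj₂ (inj₂ (inj₂ (inj₁ (loops , anti , tr′ , tot′))))
    where
    anti : ∀ x y → S x → S y → arc G x y → arc G y x → x ≡ y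
    anti x y Sx Sy xy yx = decidable-stable em λ x≢y →
      [ (λ (_ , ¬yx) → ¬yx yx) , (λ (_ , ¬xy) → ¬xy xy) ]′ (tot x y Sx Sy x≢y)

    tr′ : ∀ x y z → S x → S y → S z → arc G x y → arc G y z → arc G x z
    tr′ x y z Sx Sy Sz xy yz with em {x ≡ y} | em {y ≡ z}
    ... | yes refl | _        = yz
    ... | no _     | yes refl = xy
    ... | no x≢y   | no y≢z   =
      proj₁ (tr x y z Sx Sy Sz (xy , x≢y ∘ anti x y Sx Sy xy) (yz , y≢z ∘ anti y z Sy Sz yz))

    tot′ : ∀ x y → S x → S y → arc G x y ⊎ arc G y x
    tot′ x y Sx Sy with em {x ≡ y}
    ... | yes refl = inj₁ (loops x Sx)
    ... | no x≢y   = [ inj₁ ∘ proj₁ , inj₂ ∘ proj₁ ]′ (tot x y Sx Sy x≢y)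
  homogeneous⇒sixKinds {S} (inj₁ (tot , tr)) (inj₂ irr) =
    inj₁ (irr ,
          (λ x y Sx Sy x≢y →
             [ (λ (xy , ¬yx) → inj₁ xy , ¬yx ∘ proj₂)
             , (λ (yx , ¬xy) → inj₂ yx , ¬xy ∘ proj₁) ]′ (tot x y Sx Sy x≢y)) ,
          λ x y z Sx Sy Sz xy yz →
            proj₁ (tr x y z Sx Sy Sz (strict x y Sx Sy xy) (strict y z Sy Sz yz)))
    where
    strict : ∀ x y → S x → S y → arc G x y → x ⟶ y
    strict x y Sx Sy xy =
      [ (λ x⟶y → x⟶y) , (λ (_ , ¬xy) → ⊥-elim (¬xy xy)) ]′
      (tot x y Sx Sy λ { refl → irr x Sx xy })
  homogeneous⇒sixKinds {S} (inj₂ (inj₁ cp)) (inj₁ loops) =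
    inj₂ (inj₂ (inj₂ (inj₂ (inj₁ all))))
    where
    all : ∀ x y → S x → S y → arc G x y
    all x y Sx Sy with em {x ≡ y}
    ... | yes refl = loops x Sx
    ... | no x≢y   = cp x y Sx Sy x≢y
  homogeneous⇒sixKinds (inj₂ (inj₁ cp)) (inj₂ irr) =
    inj₂ (inj₁ λ x y Sx Sy → mk⇔ (λ { xy refl → irr x Sx xy }) (cp x y Sx Sy))
  homogeneous⇒sixKinds (inj₂ (inj₂ ep)) (inj₁ loops) =
    inj₂ (inj₂ (inj₂ (inj₂ (inj₂ λ x y Sx Sy →
      mk⇔ (λ xy → decidable-stable em λ x≢y → ep x y Sx Sy x≢y xy) λ { refl → loops x Sx }))))
  homogeneous⇒sixKinds {S} (inj₂ (inj₂ ep)) (inj₂ irr) = inj₂ (inj₂ (inj₁ none))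
    where
    none : ∀ x y → S x → S y → ¬ arc G x y
    none x y Sx Sy xy with em {x ≡ y}
    ... | yes refl = irr x Sx xy
    ... | no x≢y   = ep x y Sx Sy x≢y xy

  homogeneous-⊆ : ∀ {S T} → (∀ v → S v → T v) → Homogeneous T → Homogeneous S
  homogeneous-⊆ S⊆T (inj₁ (tot , tr)) =
    inj₁ ((λ x y Sx Sy → tot x y (S⊆T x Sx) (S⊆T y Sy)) ,
          λ x y z Sx Sy Sz → tr x y z (S⊆T x Sx) (S⊆T y Sy) (S⊆T z Sz))
  homogeneous-⊆ S⊆T (inj₂ (inj₁ cp)) =
    inj₂ (inj₁ λ x y Sx Sy → cp x y (S⊆T x Sx) (S⊆T y Sy))
  homogeneous-⊆ S⊆T (inj₂ (inj₂ ep)) =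
    inj₂ (inj₂ λ x y Sx Sy → ep x y (S⊆T x Sx) (S⊆T y Sy))

  loopUniform-⊆ : ∀ {S T} → (∀ v → S v → T v) → LoopUniform T → LoopUniform S
  loopUniform-⊆ S⊆T (inj₁ loops) = inj₁ λ x Sx → loops x (S⊆T x Sx)
  loopUniform-⊆ S⊆T (inj₂ irr)   = inj₂ λ x Sx → irr x (S⊆T x Sx)

  Autonomous : Subset (V G) → Set
  Autonomous A = ∀ x x' y → A x → A x' → ¬ A y →
    (arc G x y ⇔ arc G x' y) × (arc G y x ⇔ arc G y x')

  record Good (S : Subset (V G)) : Set where
    field
      autonomous  : Autonomous S
      homogeneous : Homogeneous S
      loopUniform : LoopUniform S

  open Good public

-- Isomorphism invariants of small tuples.

module Tuples (G : Digraph) where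

  -- The relation `Q` is kept abstract: `arc G` and `_⟶_` give sources, `flip _⟶_` gives sinks.
  HasSource : (V G → V G → Set) → ∀ {n} → (Fin n → V G) → Set
  HasSource Q a = ∃ λ i → ∀ j → j ≢ i → Q (a i) (a j)

  Invariant : (V G → V G → Set) → Set
  Invariant Q = ∀ {n} (a a' : Fin n → V G) ((σ , _) : InducedIso G a a') i j →
    Q (a i) (a j) → Q (a' (Inverse.to σ i)) (a' (Inverse.to σ j))

  hasSource-iso : ∀ Q {n} → Invariant Q → (a a' : Fin n → V G) → InducedIso G a a' →
    HasSource Q a → HasSource Q a'
  hasSource-iso Q inv a a' iso@(σ , _) (i , src) = to i , λ j j≢ →
    subst (λ k → Q (a' (to i)) (a' k)) (strictlyInverseˡ j)
      (inv a a' iso i (from j) (src (from j) λ e → j≢ (trans (sym (strictlyInverseˡ j)) (cong to e))))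
    where open Inverse σ using (to; from; strictlyInverseˡ)

  module _ (Q : V G → V G → Set) where

    Source₃ : V G → V G → V G → Set
    Source₃ x y z = (Q x y × Q x z) ⊎ (Q y x × Q y z) ⊎ (Q z x × Q z y)

    source₃⇒hasSource : ∀ {x y z} → Source₃ x y z → HasSource Q (lookup (x ∷ y ∷ z ∷ []))
    source₃⇒hasSource (inj₁ (xy , xz)) = zero , λ where
      zero ne → ⊥-elim (ne refl)
      (suc zero) _ → xy
      (suc (suc zero)) _ → xz
    source₃⇒hasSource (inj₂ (inj₁ (yx , yz))) = suc zero , λ where
      zero _ → yx
      (suc zero) ne → ⊥-elim (ne refl)
      (suc (suc zero)) _ → yz
    source₃⇒hasSource (inj₂ (inj₂ (zx , zy))) = suc (suc zero) , λ where
      zero _ → zx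
      (suc zero) _ → zy
      (suc (suc zero)) ne → ⊥-elim (ne refl)

    hasSource⇒source₃ : ∀ {x y z} → HasSource Q (lookup (x ∷ y ∷ z ∷ [])) → Source₃ x y z
    hasSource⇒source₃ (zero , h) = inj₁ (h (suc zero) (λ ()) , h (suc (suc zero)) (λ ()))
    hasSource⇒source₃ (suc zero , h) = inj₂ (inj₁ (h zero (λ ()) , h (suc (suc zero)) (λ ())))
    hasSource⇒source₃ (suc (suc zero) , h) = inj₂ (inj₂ (h zero (λ ()) , h (suc zero) (λ ())))

  source₃-iso : ∀ {x y z x' y' z'} Q → Invariant Q →
    InducedIso G (lookup (x ∷ y ∷ z ∷ [])) (lookup (x' ∷ y' ∷ z' ∷ [])) →
    Source₃ Q x y z → Source₃ Q x' y' z'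
  source₃-iso {x} {y} {z} {x'} {y'} {z'} Q inv iso =
    hasSource⇒source₃ Q ∘
    hasSource-iso Q inv (lookup (x ∷ y ∷ z ∷ [])) (lookup (x' ∷ y' ∷ z' ∷ [])) iso ∘
    source₃⇒hasSource Q

  -- The only permutations of two positions are the identity and the swap. Loops are recorded for
  -- the swap, where they compare two vertices in different positions.
  pair-cases : ∀ {x y x' y'} → InducedIso G (lookup (x ∷ y ∷ [])) (lookup (x' ∷ y' ∷ [])) →
    ((arc G x y ⇔ arc G x' y') × (arc G y x ⇔ arc G y' x')) ⊎
    ((arc G x y ⇔ arc G y' x') × (arc G y x ⇔ arc G x' y') × (arc G x x ⇔ arc G y' y'))
  pair-cases (σ , h)
    with Inverse.to σ zero in e₀ | Inverse.to σ (suc zero) in e₁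
       | h zero zero | h zero (suc zero) | h (suc zero) zero
  ... | zero     | suc zero | _  | xy | yx = inj₁ (xy , yx)
  ... | suc zero | zero     | xx | xy | yx = inj₂ (xy , yx , xx)
  ... | zero     | zero     | _  | _  | _  with () ← Injection.injective (↔⇒↣ σ) (trans e₀ (sym e₁))
  ... | suc zero | suc zero | _  | _  | _  with () ← Injection.injective (↔⇒↣ σ) (trans e₀ (sym e₁))

  loop-iso : ∀ {x x'} → InducedIso G (lookup (x ∷ [])) (lookup (x' ∷ [])) →
    arc G x x ⇔ arc G x' x'
  loop-iso (σ , h) with Inverse.to σ zero | h zero zero
  ... | zero | xx = xx

-- The hull of an infinite monomorphic part is good.

module InfinitePart (em : ExcludedMiddle 0ℓ) (G : Digraph) {B : Subset (V G)}
                    (part : IsMonomorphicPart G B) (inf : Infinite B) where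
  open Kinds em G
  open Tuples G

  -- `Finite` asks only for a list that covers the set, so if every member of `B` occurred in `xs`,
  -- then `lookup xs` itself would witness finiteness.
  fresh : ∀ {n} (xs : Vec (V G) n) → ∃ λ x → B x × (∀ i → lookup xs i ≢ x)
  fresh xs = decidable-stable em λ ¬fresh → inf (_ , lookup xs , λ v Bv →
    decidable-stable em λ ¬∈ → ¬fresh (v , Bv , λ i e → ¬∈ (i , e)))

  -- Entries of `xs` and `ys` lie in `B`, so outside `B` both tuples have exactly the vertices that
  -- `F` contributes. The fixed suffix `F` may itself meet `B`.
  exchange : ∀ {n k} {xs ys : Vec (V G) n} (F : Vec (V G) k) → All B xs → All B ys →
    Unique (xs ++ F) → Unique (ys ++ F) →
    InducedIso G (lookup (xs ++ F)) (lookup (ys ++ F))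
  exchange F Bxs Bys uxs uys =
    part _ _ _ (lookup-injective uxs _ _) (lookup-injective uys _ _)
      λ v → mk⇔ (λ (v∈ , ¬Bv) → outside Bxs Bys ¬Bv v∈ , ¬Bv)
                (λ (v∈ , ¬Bv) → outside Bys Bxs ¬Bv v∈ , ¬Bv)
    where
    outside : ∀ {n v} {xs ys : Vec (V G) n} → All B xs → All B ys → ¬ B v →
      v ∈Img lookup (xs ++ F) → v ∈Img lookup (ys ++ F)
    outside []         []         _   v∈           = v∈
    outside (Bx ∷ _)   (_ ∷ _)    ¬Bv (zero , refl) = ⊥-elim (¬Bv Bx)
    outside (_ ∷ Bxs)  (_ ∷ Bys)  ¬Bv (suc i , e)
      with (j , e′) ← outside Bxs Bys ¬Bv (i , e) = suc j , e′

  ⟶-invariant : Invariant _⟶_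
  ⟶-invariant _ _ (_ , h) i j (ij , ¬ji) = ⇒ (h i j) ij , ¬ji ∘ ⇐ (h j i)

  module _ {x y z x' y' z' : V G}
           (iso : InducedIso G (lookup (x ∷ y ∷ z ∷ [])) (lookup (x' ∷ y' ∷ z' ∷ []))) where

    arc-source₃ : Source₃ (arc G) x y z → Source₃ (arc G) x' y' z'
    arc-source₃ = source₃-iso (arc G) (λ _ _ (_ , h) i j → ⇒ (h i j)) iso

    ⟶-source₃ : Source₃ _⟶_ x y z → Source₃ _⟶_ x' y' z'
    ⟶-source₃ = source₃-iso _⟶_ ⟶-invariant iso

    ⟶-sink₃ : Source₃ (flip _⟶_) x y z → Source₃ (flip _⟶_) x' y' z'
    ⟶-sink₃ = source₃-iso (flip _⟶_) (λ a a' iso i j → ⟶-invariant a a' iso j i) iso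

  comparable-iso : ∀ {x y x' y'} →
    InducedIso G (lookup (x ∷ y ∷ [])) (lookup (x' ∷ y' ∷ [])) →
    Comparable x y → Comparable x' y'
  comparable-iso iso c with pair-cases iso | c
  ... | inj₁ (e , e′)     | inj₁ (p , q) = inj₁ (⇒ e p , q ∘ ⇐ e′)
  ... | inj₁ (e , e′)     | inj₂ (p , q) = inj₂ (⇒ e′ p , q ∘ ⇐ e)
  ... | inj₂ (e , e′ , _) | inj₁ (p , q) = inj₂ (⇒ e p , q ∘ ⇐ e′)
  ... | inj₂ (e , e′ , _) | inj₂ (p , q) = inj₁ (⇒ e′ p , q ∘ ⇐ e)

  exchange-pair : ∀ {x x' y} → B x → B x' → x ≢ y → x' ≢ y →
    InducedIso G (lookup (x ∷ y ∷ [])) (lookup (x' ∷ y ∷ []))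
  exchange-pair Bx Bx' x≢y x'≢y =
    exchange (_ ∷ []) (Bx ∷ []) (Bx' ∷ []) ((x≢y ∷ []) ∷ [] ∷ []) ((x'≢y ∷ []) ∷ [] ∷ [])

  exchange-within : ∀ {x y x' y'} → B x → B y → B x' → B y' → x ≢ y → x' ≢ y' →
    InducedIso G (lookup (x ∷ y ∷ [])) (lookup (x' ∷ y' ∷ []))
  exchange-within Bx By Bx' By' x≢y x'≢y' =
    exchange [] (Bx ∷ By ∷ []) (Bx' ∷ By' ∷ []) ((x≢y ∷ []) ∷ [] ∷ []) ((x'≢y' ∷ []) ∷ [] ∷ [])

  exchange₁ : ∀ {x x' y z} → B x → B x' → y ≢ z → x ≢ y → x ≢ z → x' ≢ y → x' ≢ z →
    InducedIso G (lookup (x ∷ y ∷ z ∷ [])) (lookup (x' ∷ y ∷ z ∷ []))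
  exchange₁ Bx Bx' y≢z x≢y x≢z x'≢y x'≢z = exchange (_ ∷ _ ∷ []) (Bx ∷ []) (Bx' ∷ [])
    ((x≢y ∷ x≢z ∷ []) ∷ (y≢z ∷ []) ∷ [] ∷ []) ((x'≢y ∷ x'≢z ∷ []) ∷ (y≢z ∷ []) ∷ [] ∷ [])

  exchange₂ : ∀ {x y x' y' w} → B x → B y → B x' → B y' →
    x ≢ y → x ≢ w → y ≢ w → x' ≢ y' → x' ≢ w → y' ≢ w →
    InducedIso G (lookup (x ∷ y ∷ w ∷ [])) (lookup (x' ∷ y' ∷ w ∷ []))
  exchange₂ Bx By Bx' By' x≢y x≢w y≢w x'≢y' x'≢w y'≢w =
    exchange (_ ∷ []) (Bx ∷ By ∷ []) (Bx' ∷ By' ∷ [])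
      ((x≢y ∷ x≢w ∷ []) ∷ (y≢w ∷ []) ∷ [] ∷ []) ((x'≢y' ∷ x'≢w ∷ []) ∷ (y'≢w ∷ []) ∷ [] ∷ [])

  -- y may itself belong to B.
  Splits : V G → Set
  Splits y = ∃ λ x → ∃ λ x' → B x × B x' × x ⟶ y × y ⟶ x'

  Hull : Subset (V G)
  Hull y = B y ⊎ Splits y

  splitter-comparable : ∀ {y x} → Splits y → B x → x ≢ y → Comparable x y
  splitter-comparable (u , _ , Bu , _ , u⟶y , _) Bx x≢y =
    comparable-iso (exchange-pair Bu Bx (⟶⇒≢ u⟶y) x≢y) (inj₁ u⟶y)

  -- Exchanging `x` for `x'` next to `z` either keeps the two directions, which is the claim, or
  -- swaps them. A swap is harmless if `x` and `z` are joined both ways or not at all; otherwise it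
  -- puts `z` strictly between `x` and `x'`, hence into the hull.
  part-uniform : ∀ {x x' z} → ¬ Hull z → B x → B x' →
    (arc G x z ⇔ arc G x' z) × (arc G z x ⇔ arc G z x')
  part-uniform {x} {x'} {z} ¬Hz Bx Bx'
    with pair-cases (exchange-pair {y = z} Bx Bx' (λ { refl → ¬Hz (inj₁ Bx) }) λ { refl → ¬Hz (inj₁ Bx') })
  ... | inj₁ e = e
  ... | inj₂ (e , e′ , _) with em {arc G x z} | em {arc G z x}
  ... | yes xz | yes zx = mk⇔ (λ _ → ⇒ e′ zx) (λ _ → xz) , mk⇔ (λ _ → ⇒ e xz) (λ _ → zx)
  ... | yes xz | no ¬zx = ⊥-elim (¬Hz (inj₂ (x , x' , Bx , Bx' , (xz , ¬zx) , (⇒ e xz , ¬zx ∘ ⇐ e′))))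
  ... | no ¬xz | yes zx = ⊥-elim (¬Hz (inj₂ (x' , x , Bx' , Bx , (⇒ e′ zx , ¬xz ∘ ⇐ e) , (zx , ¬xz))))
  ... | no ¬xz | no ¬zx =
    mk⇔ (λ xz → ⊥-elim (¬xz xz)) (λ x'z → ⊥-elim (¬zx (⇐ e′ x'z))) ,
    mk⇔ (λ zx → ⊥-elim (¬zx zx)) (λ zx' → ⊥-elim (¬xz (⇐ e zx')))

  private
    -- `A`, `A'` are the two directions of one pair, `C`, `C'` those of another. Once strict arcs
    -- carry over, the only discrepancy left is a double arc against no arc, which `sym?` rules out.
    transfer : {A A' C C' : Set} → (A × ¬ A' → C) → (C' × ¬ C → ¬ A) →
      ¬ (A × A' × ¬ C × ¬ C') → A → C
    transfer {A} {A'} {C} {C'} strict back sym? a with em {A'} | em {C} | em {C'}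
    ... | no ¬a' | _     | _      = strict (a , ¬a')
    ... | yes _  | yes c | _      = c
    ... | yes a' | no ¬c | yes c' = ⊥-elim (back (c' , ¬c) a)
    ... | yes a' | no ¬c | no ¬c' = ⊥-elim (sym? (a , a' , ¬c , ¬c'))

  -- Since `z` relates equally to `x` and `x'` while `x ⟶ y ⟶ x'`, exchanging `x` and `x'` in the
  -- triple with `y` and `z` must hand its source or sink to a known vertex, and this fixes how `y`
  -- relates to `z`.
  splitter-uniform : ∀ {y z} ((x , _) : Splits y) → ¬ Hull z →
    (arc G y z ⇔ arc G x z) × (arc G z y ⇔ arc G z x)
  splitter-uniform {y} {z} spl@(x , x' , Bx , Bx' , x⟶y , y⟶x') ¬Hz =
    mk⇔ (transfer (proj₁ ∘ y⟶z⇒x⟶z) (proj₂ ∘ z⟶x⇒z⟶y) ¬y=z≠x)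
        (transfer (proj₁ ∘ x⟶z⇒y⟶z) (proj₂ ∘ z⟶y⇒z⟶x) ¬x=z≠y) ,
    mk⇔ (transfer (proj₁ ∘ z⟶y⇒z⟶x) (proj₂ ∘ x⟶z⇒y⟶z) λ (zy , yz , ¬zx , ¬xz) → ¬y=z≠x (yz , zy , ¬xz , ¬zx))
        (transfer (proj₁ ∘ z⟶x⇒z⟶y) (proj₂ ∘ y⟶z⇒x⟶z) λ (zx , xz , ¬zy , ¬yz) → ¬x=z≠y (xz , zx , ¬yz , ¬zy))
    where
    uni = part-uniform ¬Hz Bx Bx'

    iso = exchange₁ {x} {x'} {y} {z} Bx Bx' (λ { refl → ¬Hz (inj₂ spl) })
      (⟶⇒≢ x⟶y) (λ { refl → ¬Hz (inj₁ Bx) }) (≢-sym (⟶⇒≢ y⟶x')) (λ { refl → ¬Hz (inj₁ Bx') })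
    iso⁻¹ = exchange₁ {x'} {x} {y} {z} Bx' Bx (λ { refl → ¬Hz (inj₂ spl) })
      (≢-sym (⟶⇒≢ y⟶x')) (λ { refl → ¬Hz (inj₁ Bx') }) (⟶⇒≢ x⟶y) (λ { refl → ¬Hz (inj₁ Bx) })

    -- Here `x` is a source. After the exchange `x'` is not one because of `y ⟶ x'`, nor is `z` by
    -- uniformity, so `y` is.
    x⟶z⇒y⟶z : x ⟶ z → y ⟶ z
    x⟶z⇒y⟶z x⟶z with ⟶-source₃ iso (inj₁ (x⟶y , x⟶z))
    ... | inj₁ (x'⟶y , _)        = ⊥-elim (⟶-asym x'⟶y y⟶x')
    ... | inj₂ (inj₁ (_ , y⟶z))  = y⟶z
    ... | inj₂ (inj₂ (z⟶x' , _)) = ⊥-elim (proj₂ x⟶z (⇐ (proj₂ uni) (proj₁ z⟶x')))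

    y⟶z⇒x⟶z : y ⟶ z → x ⟶ z
    y⟶z⇒x⟶z y⟶z with ⟶-source₃ iso⁻¹ (inj₂ (inj₁ (y⟶x' , y⟶z)))
    ... | inj₁ (_ , x⟶z)        = x⟶z
    ... | inj₂ (inj₁ (y⟶x , _)) = ⊥-elim (⟶-asym y⟶x x⟶y)
    ... | inj₂ (inj₂ (_ , z⟶y)) = ⊥-elim (⟶-asym z⟶y y⟶z)

    z⟶x⇒z⟶y : z ⟶ x → z ⟶ y
    z⟶x⇒z⟶y (zx , ¬xz) with ⟶-sink₃ iso⁻¹ (inj₁ (y⟶x' , (⇒ (proj₂ uni) zx , ¬xz ∘ ⇐ (proj₁ uni))))
    ... | inj₁ (y⟶x , _)        = ⊥-elim (⟶-asym y⟶x x⟶y)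
    ... | inj₂ (inj₁ (_ , z⟶y)) = z⟶y
    ... | inj₂ (inj₂ (x⟶z , _)) = ⊥-elim (¬xz (proj₁ x⟶z))

    z⟶y⇒z⟶x : z ⟶ y → z ⟶ x
    z⟶y⇒z⟶x z⟶y with ⟶-sink₃ iso (inj₂ (inj₁ (x⟶y , z⟶y)))
    ... | inj₁ (_ , (zx' , ¬x'z)) = ⇐ (proj₂ uni) zx' , ¬x'z ∘ ⇒ (proj₁ uni)
    ... | inj₂ (inj₁ (x'⟶y , _))  = ⊥-elim (⟶-asym x'⟶y y⟶x')
    ... | inj₂ (inj₂ (_ , y⟶z))   = ⊥-elim (⟶-asym y⟶z z⟶y)

    -- A double arc against no arc is invisible to `⟶`, so sources for `arc G` are used: `x` is one,
    -- and after the exchange no vertex can be.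
    ¬x=z≠y : ¬ (arc G x z × arc G z x × ¬ arc G y z × ¬ arc G z y)
    ¬x=z≠y (xz , _ , ¬yz , ¬zy) with arc-source₃ iso (inj₁ (proj₁ x⟶y , xz))
    ... | inj₁ (x'y , _)       = proj₂ y⟶x' x'y
    ... | inj₂ (inj₁ (_ , yz)) = ¬yz yz
    ... | inj₂ (inj₂ (_ , zy)) = ¬zy zy

    ¬y=z≠x : ¬ (arc G y z × arc G z y × ¬ arc G x z × ¬ arc G z x)
    ¬y=z≠x (yz , _ , ¬xz , ¬zx) with arc-source₃ iso⁻¹ (inj₂ (inj₁ (proj₁ y⟶x' , yz)))
    ... | inj₁ (_ , xz)        = ¬xz xz
    ... | inj₂ (inj₁ (yx , _)) = proj₂ x⟶y yx
    ... | inj₂ (inj₂ (zx , _)) = ¬zx zx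

  private
    base : ∃ B
    base = let (x , Bx , _) = fresh [] in x , Bx

  hull-autonomous : Autonomous Hull
  hull-autonomous u u' z Hu Hu' ¬Hz =
    let (p , q) = like-base Hu ; (p' , q') = like-base Hu' in
    ⇔-sym p' ⇔-∘ p , ⇔-sym q' ⇔-∘ q
    where
    like-base : ∀ {u} → Hull u →
      (arc G u z ⇔ arc G (proj₁ base) z) × (arc G z u ⇔ arc G z (proj₁ base))
    like-base (inj₁ Bu) = part-uniform ¬Hz Bu (proj₂ base)
    like-base (inj₂ spl@(_ , _ , Bx , _)) =
      let (p , q) = splitter-uniform spl ¬Hz ; (p' , q') = part-uniform ¬Hz Bx (proj₂ base) in
      p' ⇔-∘ p , q' ⇔-∘ q

  part-loop : ∀ {x x'} → B x → B x' → arc G x x ⇔ arc G x' x'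
  part-loop Bx Bx' = loop-iso (exchange [] (Bx ∷ []) (Bx' ∷ []) ([] ∷ []) ([] ∷ []))

  -- For a splitter `u`, exchanging `x` for `x'` beside `u` reverses the strict arc, so the
  -- isomorphism must be the swap; it sends `x` to `u` and carries the loop along.
  hull-loop : ∀ {u} → Hull u → arc G u u ⇔ arc G (proj₁ base) (proj₁ base)
  hull-loop (inj₁ Bu) = part-loop Bu (proj₂ base)
  hull-loop (inj₂ (x , x' , Bx , Bx' , x⟶u , u⟶x'))
    with pair-cases (exchange-pair Bx Bx' (⟶⇒≢ x⟶u) (≢-sym (⟶⇒≢ u⟶x')))
  ... | inj₁ (e , _)     = ⊥-elim (proj₂ u⟶x' (⇒ e (proj₁ x⟶u)))
  ... | inj₂ (_ , _ , e) = part-loop Bx (proj₂ base) ⇔-∘ ⇔-sym e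

  hull-loopUniform : LoopUniform Hull
  hull-loopUniform with em {arc G (proj₁ base) (proj₁ base)}
  ... | yes loop = inj₁ λ u Hu → ⇐ (hull-loop Hu) loop
  ... | no ¬loop = inj₂ λ u Hu uu → ¬loop (⇒ (hull-loop Hu) uu)

  module StrictPart (tournament : ∀ x y → B x → B y → x ≢ y → Comparable x y) where

    part-hull-comparable : ∀ {x w} → B x → Hull w → x ≢ w → Comparable x w
    part-hull-comparable Bx (inj₁ Bw) x≢w = tournament _ _ Bx Bw x≢w
    part-hull-comparable Bx (inj₂ spl) x≢w = splitter-comparable spl Bx x≢w

    private
      same-side : ∀ {u v w} → B u → B v → u ≢ v →
        (u ⟶ w × v ⟶ w) ⊎ (w ⟶ u × w ⟶ v) → Source₃ _⟶_ u v w
      same-side Bu Bv u≢v (inj₂ (w⟶u , w⟶v)) = inj₂ (inj₂ (w⟶u , w⟶v))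
      same-side {u} {v} Bu Bv u≢v (inj₁ (u⟶w , v⟶w)) with tournament u v Bu Bv u≢v
      ... | inj₁ u⟶v = inj₁ (u⟶v , u⟶w)
      ... | inj₂ v⟶u = inj₂ (inj₁ (v⟶u , v⟶w))

      -- Pigeonhole: among three members of `B`, two lie on the same side of `w`. If `w` precedes
      -- both it is the source; otherwise the earlier of the two is.
      source-exists : ∀ {w} → Hull w → ∃ λ u → ∃ λ v →
        B u × B v × u ≢ v × u ≢ w × v ≢ w × Source₃ _⟶_ u v w
      source-exists {w} Hw
        with (u₁ , B₁ , ∉₁) ← fresh (w ∷ [])
        with (u₂ , B₂ , ∉₂) ← fresh (w ∷ u₁ ∷ [])
        with (u₃ , B₃ , ∉₃) ← fresh (w ∷ u₁ ∷ u₂ ∷ [])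
        with part-hull-comparable B₁ Hw (≢-sym (∉₁ zero))
           | part-hull-comparable B₂ Hw (≢-sym (∉₂ zero))
           | part-hull-comparable B₃ Hw (≢-sym (∉₃ zero))
      ... | inj₁ p | inj₁ q | _ = u₁ , u₂ , B₁ , B₂ , ∉₂ (suc zero) , ≢-sym (∉₁ zero) , ≢-sym (∉₂ zero) ,
        same-side B₁ B₂ (∉₂ (suc zero)) (inj₁ (p , q))
      ... | inj₂ p | inj₂ q | _ = u₁ , u₂ , B₁ , B₂ , ∉₂ (suc zero) , ≢-sym (∉₁ zero) , ≢-sym (∉₂ zero) ,
        same-side B₁ B₂ (∉₂ (suc zero)) (inj₂ (p , q))
      ... | inj₁ p | inj₂ _ | inj₁ r = u₁ , u₃ , B₁ , B₃ , ∉₃ (suc zero) , ≢-sym (∉₁ zero) , ≢-sym (∉₃ zero) ,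
        same-side B₁ B₃ (∉₃ (suc zero)) (inj₁ (p , r))
      ... | inj₂ p | inj₁ _ | inj₂ r = u₁ , u₃ , B₁ , B₃ , ∉₃ (suc zero) , ≢-sym (∉₁ zero) , ≢-sym (∉₃ zero) ,
        same-side B₁ B₃ (∉₃ (suc zero)) (inj₂ (p , r))
      ... | inj₁ _ | inj₂ q | inj₂ r = u₂ , u₃ , B₂ , B₃ , ∉₃ (suc (suc zero)) , ≢-sym (∉₂ zero) , ≢-sym (∉₃ zero) ,
        same-side B₂ B₃ (∉₃ (suc (suc zero))) (inj₂ (q , r))
      ... | inj₂ _ | inj₁ q | inj₁ r = u₂ , u₃ , B₂ , B₃ , ∉₃ (suc (suc zero)) , ≢-sym (∉₂ zero) , ≢-sym (∉₃ zero) ,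
        same-side B₂ B₃ (∉₃ (suc (suc zero))) (inj₁ (q , r))

    cycle-sourceless : ∀ {x y z} → x ⟶ y → y ⟶ z → z ⟶ x → ¬ Source₃ _⟶_ x y z
    cycle-sourceless x⟶y y⟶z z⟶x (inj₁ (_ , x⟶z)) = ⟶-asym x⟶z z⟶x
    cycle-sourceless x⟶y y⟶z z⟶x (inj₂ (inj₁ (y⟶x , _))) = ⟶-asym y⟶x x⟶y
    cycle-sourceless x⟶y y⟶z z⟶x (inj₂ (inj₂ (_ , z⟶y))) = ⟶-asym z⟶y y⟶z

    -- All triples made of `w` and two further members of `B` are isomorphic. One of them has a
    -- source, and a cycle has none.
    acyclic-BBH : ∀ {x y w} → B x → B y → Hull w → x ⟶ y → y ⟶ w → ¬ (w ⟶ x)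
    acyclic-BBH Bx By Hw x⟶y y⟶w w⟶x =
      let (u , v , Bu , Bv , u≢v , u≢w , v≢w , src) = source-exists Hw in
      cycle-sourceless x⟶y y⟶w w⟶x
        (⟶-source₃ (exchange₂ Bu Bv Bx By u≢v u≢w v≢w (⟶⇒≢ x⟶y) (≢-sym (⟶⇒≢ w⟶x)) (⟶⇒≢ y⟶w)) src)

    below : ∀ {l x} → B l → B x → l ⟶ x → ∀ y → Hull y → x ⟶ y → l ⟶ y
    below Bl Bx l⟶x _ Hy x⟶y =
      [ (λ p → p) , (λ y⟶l → ⊥-elim (acyclic-BBH Bl Bx Hy l⟶x x⟶y y⟶l)) ]′
      (part-hull-comparable Bl Hy λ { refl → ⟶-asym l⟶x x⟶y })

    -- Transitivity on the hull is not yet available, so a bound is expressed through the hull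
    -- vertices that it precedes. The earlier of `x` and `u` serves, because a failure would be a
    -- cycle excluded by `acyclic-BBH`.
    lower-bound : ∀ {x u} → B x → B u → ∃ λ l → B l ×
      (∀ y → Hull y → x ⟶ y → l ⟶ y) × (∀ y → Hull y → u ⟶ y → l ⟶ y)
    lower-bound {x} {u} Bx Bu with em {x ≡ u}
    ... | yes refl = x , Bx , (λ _ _ p → p) , (λ _ _ p → p)
    ... | no x≢u with tournament x u Bx Bu x≢u
    ...   | inj₁ x⟶u = x , Bx , (λ _ _ p → p) , below Bx Bu x⟶u
    ...   | inj₂ u⟶x = u , Bu , below Bu Bx u⟶x , (λ _ _ p → p)

    above : ∀ {m x} → B m → B x → x ⟶ m → ∀ y → Hull y → y ⟶ x → y ⟶ m
    above Bm Bx x⟶m _ Hy y⟶x =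
      [ (λ m⟶y → ⊥-elim (acyclic-BBH Bx Bm Hy x⟶m m⟶y y⟶x)) , (λ p → p) ]′
      (part-hull-comparable Bm Hy λ { refl → ⟶-asym x⟶m y⟶x })

    upper-bound : ∀ {x u} → B x → B u → ∃ λ m → B m ×
      (∀ y → Hull y → y ⟶ x → y ⟶ m) × (∀ y → Hull y → y ⟶ u → y ⟶ m)
    upper-bound {x} {u} Bx Bu with em {x ≡ u}
    ... | yes refl = x , Bx , (λ _ _ p → p) , (λ _ _ p → p)
    ... | no x≢u with tournament x u Bx Bu x≢u
    ...   | inj₁ x⟶u = u , Bu , above Bu Bx x⟶u , (λ _ _ p → p)
    ...   | inj₂ u⟶x = x , Bx , (λ _ _ p → p) , above Bx Bu u⟶x

    -- With `l` below and `m` above both splitters, replacing the source `l` by `m` must leave a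
    -- source. It is not `m`, so it is `y` or `z`, which therefore precedes the other.
    splitters-comparable : ∀ {y z} → Splits y → Splits z → y ≢ z → Comparable y z
    splitters-comparable sy@(x , x' , Bx , Bx' , x⟶y , y⟶x') sz@(u , u' , Bu , Bu' , u⟶z , z⟶u') y≢z
      with (l , Bl , l≤x , l≤u) ← lower-bound Bx Bu
      with (m , Bm , x'≤m , u'≤m) ← upper-bound Bx' Bu'
      with l⟶y ← l≤x _ (inj₂ sy) x⟶y | l⟶z ← l≤u _ (inj₂ sz) u⟶z
      with y⟶m ← x'≤m _ (inj₂ sy) y⟶x' | z⟶m ← u'≤m _ (inj₂ sz) z⟶u'
      with ⟶-source₃ (exchange₁ Bl Bm y≢z (⟶⇒≢ l⟶y) (⟶⇒≢ l⟶z) (≢-sym (⟶⇒≢ y⟶m)) (≢-sym (⟶⇒≢ z⟶m)))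
                     (inj₁ (l⟶y , l⟶z))
    ... | inj₁ (m⟶y , _)        = ⊥-elim (⟶-asym m⟶y y⟶m)
    ... | inj₂ (inj₁ (_ , y⟶z)) = inj₁ y⟶z
    ... | inj₂ (inj₂ (_ , z⟶y)) = inj₂ z⟶y

    -- Replacing `x` by a common lower bound of `y` and `z` gives an isomorphic triple with a
    -- source.
    acyclic-BSS : ∀ {x y z} → B x → Splits y → Splits z → x ⟶ y → y ⟶ z → ¬ (z ⟶ x)
    acyclic-BSS Bx sy@(u , _ , Bu , _ , u⟶y , _) sz@(v , _ , Bv , _ , v⟶z , _) x⟶y y⟶z z⟶x =
      let (l , Bl , l≤u , l≤v) = lower-bound Bu Bv
          l⟶y = l≤u _ (inj₂ sy) u⟶y
          l⟶z = l≤v _ (inj₂ sz) v⟶z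
      in cycle-sourceless x⟶y y⟶z z⟶x
           (⟶-source₃ (exchange₁ Bl Bx (⟶⇒≢ y⟶z) (⟶⇒≢ l⟶y) (⟶⇒≢ l⟶z) (⟶⇒≢ x⟶y) (≢-sym (⟶⇒≢ z⟶x)))
                      (inj₁ (l⟶y , l⟶z)))

    -- No vertex of the cycle is known to lie in `B`, so a fourth one is added for the exchange. A
    -- vertex `l` of `B` below the cycle is a source of the quadruple; a vertex `m` above it leaves
    -- none, as every vertex of the cycle has a predecessor in it.
    acyclic-SSS : ∀ {x y z} → Splits x → Splits y → Splits z → x ⟶ y → y ⟶ z → ¬ (z ⟶ x)
    acyclic-SSS {x} {y} {z} sx@(a , a' , Ba , Ba' , a⟶x , x⟶a') sy@(b , b' , Bb , Bb' , b⟶y , y⟶b')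
                sz@(c , c' , Bc , Bc' , c⟶z , z⟶c') x⟶y y⟶z z⟶x
      with (k , Bk , k≤a , k≤b) ← lower-bound Ba Bb
      with (l , Bl , l≤k , l≤c) ← lower-bound Bk Bc
      with (n , Bn , a'≤n , b'≤n) ← upper-bound Ba' Bb'
      with (m , Bm , n≤m , c'≤m) ← upper-bound Bn Bc'
      with l⟶x ← l≤k _ (inj₂ sx) (k≤a _ (inj₂ sx) a⟶x)
         | l⟶y ← l≤k _ (inj₂ sy) (k≤b _ (inj₂ sy) b⟶y)
         | l⟶z ← l≤c _ (inj₂ sz) c⟶z
         | x⟶m ← n≤m _ (inj₂ sx) (a'≤n _ (inj₂ sx) x⟶a')
         | y⟶m ← n≤m _ (inj₂ sy) (b'≤n _ (inj₂ sy) y⟶b')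
         | z⟶m ← c'≤m _ (inj₂ sz) z⟶c'
      = sourceless (hasSource-iso _⟶_ ⟶-invariant (lookup (l ∷ x ∷ y ∷ z ∷ [])) (lookup (m ∷ x ∷ y ∷ z ∷ [])) iso source)
      where
      cycle-unique : Unique (x ∷ y ∷ z ∷ [])
      cycle-unique = (⟶⇒≢ x⟶y ∷ ≢-sym (⟶⇒≢ z⟶x) ∷ []) ∷ (⟶⇒≢ y⟶z ∷ []) ∷ [] ∷ []

      iso : InducedIso G (lookup (l ∷ x ∷ y ∷ z ∷ [])) (lookup (m ∷ x ∷ y ∷ z ∷ []))
      iso = exchange (x ∷ y ∷ z ∷ []) (Bl ∷ []) (Bm ∷ [])
        ((⟶⇒≢ l⟶x ∷ ⟶⇒≢ l⟶y ∷ ⟶⇒≢ l⟶z ∷ []) ∷ cycle-unique)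
        ((≢-sym (⟶⇒≢ x⟶m) ∷ ≢-sym (⟶⇒≢ y⟶m) ∷ ≢-sym (⟶⇒≢ z⟶m) ∷ []) ∷ cycle-unique)

      source : HasSource _⟶_ (lookup (l ∷ x ∷ y ∷ z ∷ []))
      source = zero , λ where
        zero ne → ⊥-elim (ne refl)
        (suc zero) _ → l⟶x
        (suc (suc zero)) _ → l⟶y
        (suc (suc (suc zero))) _ → l⟶z

      sourceless : ¬ HasSource _⟶_ (lookup (m ∷ x ∷ y ∷ z ∷ []))
      sourceless (zero , h) = ⟶-asym (h (suc zero) λ ()) x⟶m
      sourceless (suc zero , h) = ⟶-asym (h (suc (suc (suc zero))) λ ()) z⟶x
      sourceless (suc (suc zero) , h) = ⟶-asym (h (suc zero) λ ()) x⟶y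
      sourceless (suc (suc (suc zero)) , h) = ⟶-asym (h (suc (suc zero)) λ ()) y⟶z

    hull-comparable : ∀ x y → Hull x → Hull y → x ≢ y → Comparable x y
    hull-comparable _ _ (inj₁ Bx) Hy x≢y = part-hull-comparable Bx Hy x≢y
    hull-comparable _ _ (inj₂ sx) (inj₁ By) x≢y =
      [ inj₂ , inj₁ ]′ (splitter-comparable sx By (≢-sym x≢y))
    hull-comparable _ _ (inj₂ sx) (inj₂ sy) x≢y = splitters-comparable sx sy x≢y

    -- Rotating the cycle brings its vertices from `B` to the front.
    hull-acyclic : ∀ {x y z} → Hull x → Hull y → Hull z → x ⟶ y → y ⟶ z → ¬ (z ⟶ x)
    hull-acyclic (inj₁ Bx) (inj₁ By) Hz        xy yz zx = acyclic-BBH Bx By Hz xy yz zx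
    hull-acyclic (inj₁ Bx) (inj₂ sy) (inj₁ Bz) xy yz zx = acyclic-BBH Bz Bx (inj₂ sy) zx xy yz
    hull-acyclic (inj₂ sx) (inj₁ By) (inj₁ Bz) xy yz zx = acyclic-BBH By Bz (inj₂ sx) yz zx xy
    hull-acyclic (inj₁ Bx) (inj₂ sy) (inj₂ sz) xy yz zx = acyclic-BSS Bx sy sz xy yz zx
    hull-acyclic (inj₂ sx) (inj₁ By) (inj₂ sz) xy yz zx = acyclic-BSS By sz sx yz zx xy
    hull-acyclic (inj₂ sx) (inj₂ sy) (inj₁ Bz) xy yz zx = acyclic-BSS Bz sx sy zx xy yz
    hull-acyclic (inj₂ sx) (inj₂ sy) (inj₂ sz) xy yz zx = acyclic-SSS sx sy sz xy yz zx

    hull-isStrictOrder : IsStrictOrder Hull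
    hull-isStrictOrder = hull-comparable , λ x y z Hx Hy Hz x⟶y y⟶z →
      [ (λ p → p) , (λ z⟶x → ⊥-elim (hull-acyclic Hx Hy Hz x⟶y y⟶z z⟶x)) ]′
      (hull-comparable x z Hx Hz λ { refl → ⟶-asym x⟶y y⟶z })

  -- A third member `u` of `B` is comparable to `y`, hence on the same side of `y` as `x` or as
  -- `x'`. That pair makes `y` a sink or a source; exchanged for `x` and `x'`, which lie on opposite
  -- sides of `y`, it leaves a triple whose sink or source would need a strict arc inside `B`.
  part-symmetric⇒unsplit : (∀ x y → B x → B y → ¬ (x ⟶ y)) → ∀ {y} → ¬ Splits y
  part-symmetric⇒unsplit symm {y} spl@(x , x' , Bx , Bx' , x⟶y , y⟶x')
    with (u , Bu , ∉) ← fresh (x ∷ x' ∷ y ∷ [])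
    with splitter-comparable spl Bu (≢-sym (∉ (suc (suc zero))))
  ... | inj₁ u⟶y = [ symm x' x Bx' Bx ∘ proj₁ ,
                   [ symm x x' Bx Bx' ∘ proj₁ , (λ (_ , x'⟶y) → ⟶-asym x'⟶y y⟶x') ]′ ]′
      (⟶-sink₃ (exchange₂ Bx Bu Bx Bx' (∉ zero) (⟶⇒≢ x⟶y) (⟶⇒≢ u⟶y)
                          (λ { refl → ⟶-asym x⟶y y⟶x' }) (⟶⇒≢ x⟶y) (≢-sym (⟶⇒≢ y⟶x')))
               (inj₂ (inj₂ (x⟶y , u⟶y))))
  ... | inj₂ y⟶u = [ symm x x' Bx Bx' ∘ proj₁ ,
                   [ symm x' x Bx' Bx ∘ proj₁ , (λ (y⟶x , _) → ⟶-asym y⟶x x⟶y) ]′ ]′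
      (⟶-source₃ (exchange₂ Bx' Bu Bx Bx' (∉ (suc zero)) (≢-sym (⟶⇒≢ y⟶x')) (≢-sym (⟶⇒≢ y⟶u))
                            (λ { refl → ⟶-asym x⟶y y⟶x' }) (⟶⇒≢ x⟶y) (≢-sym (⟶⇒≢ y⟶x')))
                 (inj₂ (inj₂ (y⟶x' , y⟶u))))

  hull-homogeneous : Homogeneous Hull
  hull-homogeneous with em {∃ λ x → ∃ λ y → B x × B y × x ⟶ y}
  ... | yes (x , y , Bx , By , x⟶y) = inj₁ (StrictPart.hull-isStrictOrder λ x' y' Bx' By' x'≢y' →
        comparable-iso (exchange-within Bx By Bx' By' (⟶⇒≢ x⟶y) x'≢y') (inj₁ x⟶y))
  ... | no ¬strict = inj₂ (homogeneous′ (em {∃ λ x → ∃ λ y → B x × B y × x ≢ y × arc G x y}))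
    where
    symmetric : ∀ {x y} → B x → B y → arc G x y → arc G y x
    symmetric Bx By xy = decidable-stable em λ ¬yx → ¬strict (_ , _ , Bx , By , xy , ¬yx)

    hull⊆part : ∀ {u} → Hull u → B u
    hull⊆part (inj₁ Bu)  = Bu
    hull⊆part (inj₂ spl) = ⊥-elim (part-symmetric⇒unsplit (λ x y Bx By p → ¬strict (x , y , Bx , By , p)) spl)

    homogeneous′ : Dec (∃ λ x → ∃ λ y → B x × B y × x ≢ y × arc G x y) → IsComplete Hull ⊎ IsEmpty Hull
    homogeneous′ (no ¬arc) = inj₂ λ x y Hx Hy x≢y xy →
      ¬arc (x , y , hull⊆part Hx , hull⊆part Hy , x≢y , xy)
    homogeneous′ (yes (x , y , Bx , By , x≢y , xy)) = inj₁ λ x' y' Hx' Hy' x'≢y' →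
      let Bx' = hull⊆part Hx' ; By' = hull⊆part Hy' in
      [ (λ (e , _) → ⇒ e xy) , (λ (e , _) → symmetric By' Bx' (⇒ e xy)) ]′
      (pair-cases (exchange-within Bx By Bx' By' x≢y x'≢y'))

  hull-good : Good Hull
  hull-good = record
    { autonomous = hull-autonomous ; homogeneous = hull-homogeneous ; loopUniform = hull-loopUniform }

-- Least elements, counting and factoring through the image, over finite index sets.

-- The order laws are asked on `J` only: they hold just for positions inside one fiber, or for
-- indices of `D` met by a given set.
least : ExcludedMiddle 0ℓ → ∀ {n} (J : Fin n → Set) (_≼_ : Fin n → Fin n → Set) →
  (∀ i j → J i → J j → i ≼ j ⊎ j ≼ i) →
  (∀ i j k → J i → J j → J k → i ≼ j → j ≼ k → i ≼ k) →
  ∃ J → ∃ λ i → J i × (∀ j → J j → i ≼ j)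
least em {zero} J _≼_ tot tr (() , _)
least em {suc n} J _≼_ tot tr inhabited with em {∃ (J ∘ suc)} | em {J zero}
... | no ¬tail | no ¬J0 = ⊥-elim (no-index inhabited)
  where
  no-index : ¬ ∃ J
  no-index (zero , J0)  = ¬J0 J0
  no-index (suc i , Ji) = ¬tail (i , Ji)
... | no ¬tail | yes J0 = zero , J0 , λ where
  zero _     → [ (λ r → r) , (λ r → r) ]′ (tot zero zero J0 J0)
  (suc j) Jj → ⊥-elim (¬tail (j , Jj))
... | yes tail | J0?
  with (i , Ji , i≼) ← least em (J ∘ suc) (λ i j → suc i ≼ suc j)
         (λ i j → tot (suc i) (suc j)) (λ i j k → tr (suc i) (suc j) (suc k)) tail
  with J0?
... | no ¬J0 = suc i , Ji , λ where
  zero J0    → ⊥-elim (¬J0 J0)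
  (suc j) Jj → i≼ j Jj
... | yes J0 with tot zero (suc i) J0 Ji
... | inj₁ 0≼i = zero , J0 , λ where
  zero _     → [ (λ r → r) , (λ r → r) ]′ (tot zero zero J0 J0)
  (suc j) Jj → tr zero (suc i) (suc j) J0 Ji Jj 0≼i (i≼ j Jj)
... | inj₂ i≼0 = suc i , Ji , λ where
  zero _     → i≼0
  (suc j) Jj → i≼ j Jj

δ : ∀ {k} → Fin k → Fin k → ℕ
δ i j with i ≟ j
... | yes _ = 1
... | no  _ = 0

-- As a sum over positions, the count can be split at any position, not only at the head.
countIn≡sum : ∀ {n k} (f : Fin n → Fin k) j → countIn f j ≡ sum (λ i → δ (f i) j)
countIn≡sum {zero}  f j = refl
countIn≡sum {suc n} f j with f zero ≟ j
... | yes _ = cong suc (countIn≡sum (f ∘ suc) j)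
... | no  _ = countIn≡sum (f ∘ suc) j

countIn-cong : ∀ {n k} {f g : Fin n → Fin k} → (∀ i → f i ≡ g i) → ∀ j → countIn f j ≡ countIn g j
countIn-cong {f = f} {g} f≗g j = trans (countIn≡sum f j)
  (trans (sum-cong-≗ (λ i → cong (λ l → δ l j) (f≗g i))) (sym (countIn≡sum g j)))

countIn-punchIn : ∀ {n k} (f : Fin (suc n) → Fin k) i j →
  countIn f j ≡ δ (f i) j + countIn (f ∘ punchIn i) j
countIn-punchIn f i j = trans (countIn≡sum f j)
  (trans (sum-remove {i = i} (λ l → δ (f l) j)) (cong (δ (f i) j +_) (sym (countIn≡sum (f ∘ punchIn i) j))))

countIn-witness : ∀ {n k} (f : Fin n → Fin k) j → countIn f j ≢ 0 → ∃ λ i → f i ≡ j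
countIn-witness {zero} f j ne = ⊥-elim (ne refl)
countIn-witness {suc n} f j ne with f zero ≟ j
... | yes e = zero , e
... | no  _ with (i , e) ← countIn-witness (f ∘ suc) j ne = suc i , e

countIn-head≢0 : ∀ {n k} (f : Fin (suc n) → Fin k) → countIn f (f zero) ≢ 0
countIn-head≢0 f with f zero ≟ f zero
... | yes _ = λ ()
... | no ne = ⊥-elim (ne refl)

punchIn-elim : ∀ {n} (i : Fin (suc n)) (P : Fin (suc n) → Set) →
  P i → (∀ k → P (punchIn i k)) → ∀ j → P j
punchIn-elim i P Pi Pin j with i ≟ j
... | yes refl = Pi
... | no i≢j   = subst P (punchIn-punchOut i≢j) (Pin (punchOut i≢j))

insert-self : ∀ {m n} i j (π : Permutation m n) → insert i j π ⟨$⟩ʳ i ≡ j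
insert-self i j π with i ≟ i
... | yes _ = refl
... | no ne = ⊥-elim (ne refl)

-- Blocks of a decomposition must be non-empty while summands may be empty; missed indices are
-- removed one at a time, and `e` embeds the remaining ones.
surjective-factor : ExcludedMiddle 0ℓ → ∀ {X : Set} {m} (p : X → Fin m) →
  ∃ λ k → Σ (X → Fin k) λ b → Σ (Fin k → Fin m) λ e →
    (∀ j → ∃ λ v → b v ≡ j) × (∀ v → e (b v) ≡ p v) × Injective _≡_ _≡_ e
surjective-factor em {m = zero} p = 0 , p , (λ i → i) , (λ ()) , (λ _ → refl) , λ e → e
surjective-factor em {m = suc m} p with em {∃ λ i → ∀ v → i ≢ p v}
... | yes (i , missed) =
  let (k , b , e , surj , e∘b , e-inj) = surjective-factor em (λ v → punchOut (missed v)) in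
  k , b , punchIn i ∘ e , surj ,
  (λ v → trans (cong (punchIn i) (e∘b v)) (punchIn-punchOut (missed v))) ,
  λ eq → e-inj (punchIn-injective i _ _ eq)
... | no onto = suc m , p , (λ i → i) ,
  (λ j → decidable-stable em λ ¬hit → onto (j , λ v e → ¬hit (v , sym e))) , (λ _ → refl) , λ e → e

-- Blocks of a decomposition are monomorphic parts.

module Blocks (em : ExcludedMiddle 0ℓ) (G : Digraph) {k : ℕ} (b : V G → Fin k) where

  -- A common vertex outside block `j` is removed from both tuples until none is left. Then both lie
  -- entirely in block `j`, and having equal length they have equal counts.
  countIn-outside : ∀ j {n} (a a' : Fin n → V G) → Injective _≡_ _≡_ a → Injective _≡_ _≡_ a' →
    (∀ v → (v ∈Img a × b v ≢ j) ⇔ (v ∈Img a' × b v ≢ j)) →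
    ∀ l → countIn (b ∘ a) l ≡ countIn (b ∘ a') l
  countIn-outside j {zero} a a' _ _ _ l = refl
  countIn-outside j {suc n} a a' inj inj' out l with em {∃ λ i → b (a i) ≢ j}
  ... | no ¬out = countIn-cong (λ i → trans (inside i) (sym (inside' i))) l
    where
    inside : ∀ i → b (a i) ≡ j
    inside i = decidable-stable em λ ne → ¬out (i , ne)
    inside' : ∀ i → b (a' i) ≡ j
    inside' i = decidable-stable em λ ne →
      let ((i₀ , e) , ne′) = ⇐ (out (a' i)) ((i , refl) , ne) in ne′ (trans (cong b (sym e)) (inside i₀))
  ... | yes (i , ne) with ((i' , a'i'≡ai) , _) ← ⇒ (out (a i)) ((i , refl) , ne) =
    trans (countIn-punchIn (b ∘ a) i l)
      (trans (cong₂ (λ v c → δ (b v) l + c) (sym a'i'≡ai)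
                (countIn-outside j (a ∘ punchIn i) (a' ∘ punchIn i')
                  (punchIn-injective i _ _ ∘ inj) (punchIn-injective i' _ _ ∘ inj')
                  (λ v → mk⇔
                    (λ (v∈ , v∉) → remaining a i a' i' inj a'i'≡ai (λ w∈ → proj₁ (⇒ (out v) (w∈ , v∉))) v∈ , v∉)
                    (λ (v∈ , v∉) → remaining a' i' a i inj' (sym a'i'≡ai) (λ w∈ → proj₁ (⇐ (out v) (w∈ , v∉))) v∈ , v∉)) l))
        (sym (countIn-punchIn (b ∘ a') i' l)))
    where
    remaining : ∀ (a : Fin (suc n) → V G) i a' i' → Injective _≡_ _≡_ a → a' i' ≡ a i →
      ∀ {v} → (v ∈Img a → v ∈Img a') → v ∈Img (a ∘ punchIn i) → v ∈Img (a' ∘ punchIn i')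
    remaining a i a' i' inj e lift (k , refl) with (l , a'l≡) ← lift (punchIn i k , refl) =
      punchOut i'≢l , trans (cong a' (punchIn-punchOut i'≢l)) a'l≡
      where
      i'≢l : i' ≢ l
      i'≢l refl = punchInᵢ≢i i k (inj (trans (sym a'l≡) e))

  block-isMonomorphicPart : IsMonomorphicDecomposition G b → ∀ j → IsMonomorphicPart G (fiber b j)
  block-isMonomorphicPart (_ , mono) j n a a' inj inj' out =
    mono n a a' inj inj' (countIn-outside j a a' inj inj' out)

-- Lexicographical sums: matching tuples with equal counts, and good sets over a prime index graph.

module LexSum (em : ExcludedMiddle 0ℓ) (G : Digraph) {m : ℕ} (D : FinDigraph m) (p : V G → Fin m)
              (lex : IsLexSum G D p) where
  open Kinds em G

  module _ (kinds : ∀ i → Homogeneous (fiber p i) × LoopUniform (fiber p i)) where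

    -- `P` and `Q` act as truth values: the arcs from, respectively to, the leading entry and any
    -- other entry of its block.
    Leads : (P Q : Set) → Fin m → ∀ {n} → (Fin n → V G) → Fin n → Set
    Leads P Q i a k = p (a k) ≡ i ×
      (∀ l → l ≢ k → p (a l) ≡ i → (arc G (a k) (a l) ⇔ P) × (arc G (a l) (a k) ⇔ Q))

    -- P and Q depend on the kind of the fiber only, hence serve for all tuples at once.
    leader : ∀ i → ∃ λ P → ∃ λ Q → ∀ {n} (a : Fin n → V G) → Injective _≡_ _≡_ a →
      (∃ λ k → p (a k) ≡ i) → ∃ (Leads P Q i a)
    leader i with proj₁ (kinds i)
    ... | inj₁ (tot , tr) = ⊤ , ⊥ , first
      where
      first : ∀ {n} (a : Fin n → V G) → Injective _≡_ _≡_ a → (∃ λ k → p (a k) ≡ i) → ∃ (Leads ⊤ ⊥ i a)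
      first {n} a inj present =
        let (k , pk , k≼) = least em (λ k → p (a k) ≡ i) _≼_ ≼-total ≼-trans present in
        k , pk , λ l l≢k pl → [ (λ e → ⊥-elim (l≢k (sym e))) ,
          (λ (kl , ¬lk) → mk⇔ (λ _ → tt) (λ _ → kl) , mk⇔ ¬lk ⊥-elim) ]′ (k≼ l pl)
        where
        _≼_ : Fin n → Fin n → Set
        k ≼ l = k ≡ l ⊎ a k ⟶ a l

        ≼-total : ∀ k l → p (a k) ≡ i → p (a l) ≡ i → k ≼ l ⊎ l ≼ k
        ≼-total k l pk pl with k ≟ l
        ... | yes k≡l = inj₁ (inj₁ k≡l)
        ... | no k≢l  = [ inj₁ ∘ inj₂ , inj₂ ∘ inj₂ ]′ (tot (a k) (a l) pk pl (k≢l ∘ inj))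

        ≼-trans : ∀ j k l → p (a j) ≡ i → p (a k) ≡ i → p (a l) ≡ i → j ≼ k → k ≼ l → j ≼ l
        ≼-trans _ _ _ _ _ _ (inj₁ refl) k≼l = k≼l
        ≼-trans _ _ _ _ _ _ j≼k (inj₁ refl) = j≼k
        ≼-trans j k l pj pk pl (inj₂ jk) (inj₂ kl) = inj₂ (tr (a j) (a k) (a l) pj pk pl jk kl)
    ... | inj₂ (inj₁ cp) = ⊤ , ⊤ , λ a inj (k , pk) → k , pk , λ l l≢k pl →
      mk⇔ (λ _ → tt) (λ _ → cp _ _ pk pl (l≢k ∘ sym ∘ inj)) ,
      mk⇔ (λ _ → tt) (λ _ → cp _ _ pl pk (l≢k ∘ inj))
    ... | inj₂ (inj₂ ep) = ⊥ , ⊥ , λ a inj (k , pk) → k , pk , λ l l≢k pl →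
      mk⇔ (ep _ _ pk pl (l≢k ∘ sym ∘ inj)) ⊥-elim ,
      mk⇔ (ep _ _ pl pk (l≢k ∘ inj)) ⊥-elim

    -- Inside the block both tuples agree with `P` and `Q`; outside it both are governed by `D` at
    -- the same pair of indices.
    leads-arc : ∀ {P Q i n} {a a' : Fin n → V G} {k k'} → Leads P Q i a k → Leads P Q i a' k' →
      ∀ l l' → l ≢ k → l' ≢ k' → p (a l) ≡ p (a' l') →
      (arc G (a k) (a l) ⇔ arc G (a' k') (a' l')) × (arc G (a l) (a k) ⇔ arc G (a' l') (a' k'))
    leads-arc {i = i} {a = a} {a'} {k} {k'} (pk , h) (pk' , h') l l' l≢k l'≢k' same with p (a l) ≟ i
    ... | yes pl =
      let (e , f) = h l l≢k pl ; (e' , f') = h' l' l'≢k' (trans (sym same) pl) in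
      ⇔-sym e' ⇔-∘ e , ⇔-sym f' ⇔-∘ f
    ... | no pl≢i =
      ⇔-sym (lex (a' k') (a' l') (λ e → pl'≢i (trans (sym e) pk'))) ⇔-∘
        (≡⇒⇔ (cong₂ D (trans pk (sym pk')) same) ⇔-∘ lex (a k) (a l) (λ e → pl≢i (trans (sym e) pk))) ,
      ⇔-sym (lex (a' l') (a' k') (λ e → pl'≢i (trans e pk'))) ⇔-∘
        (≡⇒⇔ (cong₂ D same (trans pk (sym pk'))) ⇔-∘ lex (a l) (a k) (λ e → pl≢i (trans e pk)))
      where
      pl'≢i : p (a' l') ≢ i
      pl'≢i e = pl≢i (trans same e)
      ≡⇒⇔ : ∀ {A B : Set} → A ≡ B → A ⇔ B
      ≡⇒⇔ refl = ⇔-id _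

    loop-block : ∀ {x y} → p x ≡ p y → arc G x x ⇔ arc G y y
    loop-block {x} {y} e with proj₂ (kinds (p y))
    ... | inj₁ loops = mk⇔ (λ _ → loops y refl) (λ _ → loops x e)
    ... | inj₂ irr   = mk⇔ (λ xx → ⊥-elim (irr x e xx)) (λ yy → ⊥-elim (irr y refl yy))

    -- Induction on the length: leaders of a common block are removed, the rest is matched, and the
    -- leaders are matched with each other. That the matching preserves blocks is part of the
    -- conclusion because `leads-arc` needs it.
    same-counts⇒iso : ∀ n (a a' : Fin n → V G) → Injective _≡_ _≡_ a → Injective _≡_ _≡_ a' →
      (∀ j → countIn (p ∘ a) j ≡ countIn (p ∘ a') j) →
      Σ (InducedIso G a a') λ (σ , _) → ∀ i → p (a i) ≡ p (a' (Inverse.to σ i))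
    same-counts⇒iso zero a a' _ _ _ = (Perm.id , λ ()) , λ ()
    same-counts⇒iso (suc n) a a' inj inj' counts
      with (P , Q , lead) ← leader (p (a zero))
      with (k , leads) ← lead a inj (zero , refl)
      with (k' , leads') ← lead a' inj' (countIn-witness (p ∘ a') (p (a zero))
             λ e → countIn-head≢0 (p ∘ a) (trans (counts _) e))
      with same ← trans (proj₁ leads) (sym (proj₁ leads'))
      with ((σ , arcs) , blocks) ← same-counts⇒iso n (a ∘ punchIn k) (a' ∘ punchIn k')
             (punchIn-injective k _ _ ∘ inj) (punchIn-injective k' _ _ ∘ inj')
             -- Both leaders lie in one block, so their contributions to each count cancel.
             (λ j → +-cancelˡ-≡ (δ (p (a k)) j) _ _
               (trans (sym (countIn-punchIn (p ∘ a) k j)) (trans (counts j)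
                 (trans (countIn-punchIn (p ∘ a') k' j)
                   (cong (λ l → δ l j + countIn (p ∘ a' ∘ punchIn k') j) (sym same))))))
      = (τ , punchIn-elim k _
               (punchIn-elim k _ arc-kk λ j → proj₁ (arc-lead j))
               λ i → punchIn-elim k _ (proj₂ (arc-lead i)) (arc-rest i)) ,
        punchIn-elim k _ (subst (λ l → p (a k) ≡ p (a' l)) (sym τk) same)
          λ i → subst (λ l → p (a (punchIn k i)) ≡ p (a' l)) (sym (τin i)) (blocks i)
      where
      τ = insert k k' σ
      τk : τ ⟨$⟩ʳ k ≡ k'
      τk = insert-self k k' σ
      τin : ∀ i → τ ⟨$⟩ʳ punchIn k i ≡ punchIn k' (σ ⟨$⟩ʳ i)
      τin = insert-punchIn k k' σ

      arc-kk : arc G (a k) (a k) ⇔ arc G (a' (τ ⟨$⟩ʳ k)) (a' (τ ⟨$⟩ʳ k))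
      arc-kk rewrite τk = loop-block same

      arc-lead : ∀ i →
        (arc G (a k) (a (punchIn k i)) ⇔ arc G (a' (τ ⟨$⟩ʳ k)) (a' (τ ⟨$⟩ʳ punchIn k i))) ×
        (arc G (a (punchIn k i)) (a k) ⇔ arc G (a' (τ ⟨$⟩ʳ punchIn k i)) (a' (τ ⟨$⟩ʳ k)))
      arc-lead i rewrite τk | τin i =
        leads-arc leads leads' _ _ (punchInᵢ≢i k i) (punchInᵢ≢i k' (σ ⟨$⟩ʳ i)) (blocks i)

      arc-rest : ∀ i j → arc G (a (punchIn k i)) (a (punchIn k j)) ⇔
        arc G (a' (τ ⟨$⟩ʳ punchIn k i)) (a' (τ ⟨$⟩ʳ punchIn k j))
      arc-rest i j rewrite τin i | τin j = arcs i j

    surjective⇒decomposition : (∀ i → ∃ λ v → p v ≡ i) → IsMonomorphicDecomposition G p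
    surjective⇒decomposition surj =
      surj , λ n a a' inj inj' counts → proj₁ (same-counts⇒iso n a a' inj inj' counts)

  module _ (surj : ∀ i → ∃ λ v → p v ≡ i) (prime : NoTwoElementAutonomous D)
           {U : Subset (V G)} (good : Good U) where

    Alike : V G → V G → Set
    Alike x y = ∀ z → U z → p z ≢ p x → p z ≢ p y →
      (arc G x z ⇔ arc G y z) × (arc G z x ⇔ arc G z y)

    -- Otherwise the indices of `x` and `y` form an autonomous pair. A third index is tested on a
    -- representative: one in `U` if `U` meets that fiber, where `Alike` applies, and else any
    -- vertex there, where autonomy of `U` applies.
    alike⇒≡ : ∀ {x y} → U x → U y → Alike x y → p x ≡ p y
    alike⇒≡ {x} {y} Ux Uy alike = decidable-stable em λ px≢py → prime (p x) (p y) px≢py λ where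
        _ _ _ (inj₁ refl) (inj₁ refl) _ → ⇔-id _ , ⇔-id _
        _ _ l (inj₁ refl) (inj₂ refl) l∉ → same l (l∉ ∘ inj₁) (l∉ ∘ inj₂)
        _ _ l (inj₂ refl) (inj₁ refl) l∉ →
          let (e , f) = same l (l∉ ∘ inj₁) (l∉ ∘ inj₂) in ⇔-sym e , ⇔-sym f
        _ _ _ (inj₂ refl) (inj₂ refl) _ → ⇔-id _ , ⇔-id _
      where
      via : ∀ z → p z ≢ p x → p z ≢ p y → (arc G x z ⇔ arc G y z) × (arc G z x ⇔ arc G z y) →
        (D (p x) (p z) ⇔ D (p y) (p z)) × (D (p z) (p x) ⇔ D (p z) (p y))
      via z z≢x z≢y (e , f) =
        lex y z (≢-sym z≢y) ⇔-∘ (e ⇔-∘ ⇔-sym (lex x z (≢-sym z≢x))) ,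
        lex z y z≢y ⇔-∘ (f ⇔-∘ ⇔-sym (lex z x z≢x))

      same : ∀ l → l ≢ p x → l ≢ p y → (D (p x) l ⇔ D (p y) l) × (D l (p x) ⇔ D l (p y))
      same l l≢x l≢y with em {∃ λ z → U z × p z ≡ l} | surj l
      ... | yes (z , Uz , refl) | _          = via z l≢x l≢y (alike z Uz l≢x l≢y)
      ... | no unmet            | (z , refl) =
        via z l≢x l≢y (autonomous good x y z Ux Uy λ Uz → unmet (z , Uz , refl))

    strictOrder⇒≡ : IsStrictOrder U → ∀ x y → U x → U y → p x ≡ p y
    strictOrder⇒≡ (tot , tr) x y Ux Uy = decidable-stable em λ px≢py →
      let (i , (u , Uu , pu) , i≼) = least em Met _≼_ ≼-total ≼-trans (p x , x , Ux , refl)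
          -- The second lowest index met by `U`. Both `u` and `v` precede every vertex of `U` in the
          -- remaining fibers, so they are alike.
          (j , ((v , Uv , pv) , j≢i) , j≼) = least em (λ l → Met l × l ≢ i) _≼_
            (λ k l (Mk , _) (Ml , _) → ≼-total k l Mk Ml)
            (λ j k l (Mj , _) (Mk , _) (Ml , _) → ≼-trans j k l Mj Mk Ml)
            (other i px≢py)
      in j≢i (trans (sym pv) (trans (sym (alike⇒≡ Uu Uv λ z Uz z≢u z≢v →
           let u⟶z = ≼⇒⟶ Uu Uz (≢-sym z≢u) (subst (_≼ p z) (sym pu) (i≼ (p z) (z , Uz , refl)))
               v⟶z = ≼⇒⟶ Uv Uz (≢-sym z≢v) (subst (_≼ p z) (sym pv)
                       (j≼ (p z) ((z , Uz , refl) , λ e → z≢u (trans e (sym pu)))))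
           in mk⇔ (λ _ → proj₁ v⟶z) (λ _ → proj₁ u⟶z) ,
              mk⇔ (λ zu → ⊥-elim (proj₂ u⟶z zu)) (λ zv → ⊥-elim (proj₂ v⟶z zv)))) pu))
      where
      Met : Fin m → Set
      Met l = ∃ λ u → U u × p u ≡ l

      _≼_ : Fin m → Fin m → Set
      k ≼ l = k ≡ l ⊎ D k l

      ≼⇒⟶ : ∀ {u v} → U u → U v → p u ≢ p v → p u ≼ p v → u ⟶ v
      ≼⇒⟶ Uu Uv u≢v (inj₁ e) = ⊥-elim (u≢v e)
      ≼⇒⟶ {u} {v} Uu Uv u≢v (inj₂ d) =
        [ (λ u⟶v → u⟶v) , (λ (_ , ¬uv) → ⊥-elim (¬uv (⇐ (lex u v u≢v) d))) ]′
        (tot u v Uu Uv (u≢v ∘ cong p))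

      ≼-total : ∀ k l → Met k → Met l → k ≼ l ⊎ l ≼ k
      ≼-total k l (u , Uu , refl) (v , Uv , refl) with p u ≟ p v
      ... | yes e  = inj₁ (inj₁ e)
      ... | no u≢v = [ (λ (uv , _) → inj₁ (inj₂ (⇒ (lex u v u≢v) uv)))
                     , (λ (vu , _) → inj₂ (inj₂ (⇒ (lex v u (≢-sym u≢v)) vu))) ]′
                     (tot u v Uu Uv (u≢v ∘ cong p))

      ≼-trans : ∀ j k l → Met j → Met k → Met l → j ≼ k → k ≼ l → j ≼ l
      ≼-trans _ _ _ (u , Uu , refl) (v , Uv , refl) (w , Uw , refl) j≼k k≼l
        with p u ≟ p v | p v ≟ p w | p u ≟ p w
      ... | yes e  | _      | _      = subst (_≼ p w) (sym e) k≼l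
      ... | no _   | yes e  | _      = subst (p u ≼_) e j≼k
      ... | no _   | no _   | yes e  = inj₁ e
      ... | no u≢v | no v≢w | no u≢w =
        inj₂ (⇒ (lex u w u≢w) (proj₁ (tr u v w Uu Uv Uw (≼⇒⟶ Uu Uv u≢v j≼k) (≼⇒⟶ Uv Uw v≢w k≼l))))

      other : ∀ i → p x ≢ p y → ∃ λ l → Met l × l ≢ i
      other i px≢py with p x ≟ i
      ... | no px≢i  = p x , (x , Ux , refl) , px≢i
      ... | yes refl = p y , (y , Uy , refl) , ≢-sym px≢py

    good⊆fiber : ∀ x y → U x → U y → p x ≡ p y
    good⊆fiber x y Ux Uy with homogeneous good
    ... | inj₁ so = strictOrder⇒≡ so x y Ux Uy
    ... | inj₂ (inj₁ cp) = alike⇒≡ Ux Uy λ z Uz z≢x z≢y →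
      mk⇔ (λ _ → cp y z Uy Uz (≢-sym z≢y ∘ cong p)) (λ _ → cp x z Ux Uz (≢-sym z≢x ∘ cong p)) ,
      mk⇔ (λ _ → cp z y Uz Uy (z≢y ∘ cong p)) (λ _ → cp z x Uz Ux (z≢x ∘ cong p))
    ... | inj₂ (inj₂ ep) = alike⇒≡ Ux Uy λ z Uz z≢x z≢y →
      mk⇔ (⊥-elim ∘ ep x z Ux Uz (≢-sym z≢x ∘ cong p)) (⊥-elim ∘ ep y z Uy Uz (≢-sym z≢y ∘ cong p)) ,
      mk⇔ (⊥-elim ∘ ep z x Uz Ux (z≢x ∘ cong p)) (⊥-elim ∘ ep z y Uz Uy (z≢y ∘ cong p))

-- From finite covers by good sets to lexicographical sums.

module Covers (em : ExcludedMiddle 0ℓ) (G : Digraph) where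
  open Kinds em G

  good-∅ : Good (λ _ → ⊥)
  good-∅ = record
    { autonomous = λ _ _ _ () ; homogeneous = inj₂ (inj₂ λ _ _ ()) ; loopUniform = inj₂ λ _ () }

  good-singleton : ∀ v → Good (v ≡_)
  good-singleton v = record
    { autonomous  = λ { _ _ _ refl refl _ → ⇔-id _ , ⇔-id _ }
    ; homogeneous = inj₂ (inj₂ λ { _ _ refl refl v≢v → ⊥-elim (v≢v refl) })
    ; loopUniform = loop em
    }
    where
    loop : Dec (arc G v v) → LoopUniform (v ≡_)
    loop (yes vv) = inj₁ λ { _ refl → vv }
    loop (no ¬vv) = inj₂ λ { _ refl → ¬vv }

  good-resp : ∀ {S T} → (∀ v → S v ⇔ T v) → Good S → Good T
  good-resp S⇔T good = record
    { autonomous  = λ x x' y Tx Tx' ¬Ty →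
        autonomous good x x' y (⇐ (S⇔T x) Tx) (⇐ (S⇔T x') Tx') (¬Ty ∘ ⇒ (S⇔T y))
    ; homogeneous = homogeneous-⊆ (λ v → ⇐ (S⇔T v)) (homogeneous good)
    ; loopUniform = loopUniform-⊆ (λ v → ⇐ (S⇔T v)) (loopUniform good)
    }

  good-∖ : ∀ {S T} → Good S → Good T → (∃ λ s → S s × ¬ T s) → Good (λ v → T v × ¬ S v)
  good-∖ {S} {T} goodS goodT (s , Ss , ¬Ts) = record
    { autonomous  = auto
    ; homogeneous = homogeneous-⊆ (λ _ → proj₁) (homogeneous goodT)
    ; loopUniform = loopUniform-⊆ (λ _ → proj₁) (loopUniform goodT)
    }
    where
    -- A vertex y of S ∩ T sees x and x' as s does, and s lies outside T.
    auto : Autonomous (λ v → T v × ¬ S v)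
    auto x x' y (Tx , ¬Sx) (Tx' , ¬Sx') y∉ with em {T y} | em {S y}
    ... | no ¬Ty | _      = autonomous goodT x x' y Tx Tx' ¬Ty
    ... | yes Ty | no ¬Sy = ⊥-elim (y∉ (Ty , ¬Sy))
    ... | yes Ty | yes Sy =
      let (xs , sx)   = autonomous goodT x x' s Tx Tx' ¬Ts
          (yx , xy)   = autonomous goodS y s x Sy Ss ¬Sx
          (yx' , xy') = autonomous goodS y s x' Sy Ss ¬Sx'
      in ⇔-sym xy' ⇔-∘ (xs ⇔-∘ xy) , ⇔-sym yx' ⇔-∘ (sx ⇔-∘ yx)

  -- If the new set lies inside a member of the disjoint family it is replaced by the empty set.
  -- Otherwise it has a vertex outside each member, which is what `good-∖` needs in order to
  -- subtract it from all of them.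
  disjointify : ∀ {m} (U : Fin m → Subset (V G)) → (∀ i → Good (U i)) →
    Σ (Fin m → Subset (V G)) λ T → (∀ i → Good (T i)) ×
      (∀ i j v → T i v → T j v → i ≡ j) × (∀ v → (∃ λ i → U i v) → ∃ λ i → T i v)
  disjointify {zero} U good = U , good , (λ ()) , λ _ u → u
  disjointify {suc m} U good with disjointify (U ∘ suc) (good ∘ suc)
  ... | T , goodT , disj , cover with em {∃ λ i → ∀ v → U zero v → T i v}
  ... | yes (i , U₀⊆T) = (λ _ → ⊥) VF.∷ T ,
    (λ { zero → good-∅ ; (suc j) → goodT j }) ,
    (λ { (suc j) (suc l) v Tj Tl → cong suc (disj j l v Tj Tl) }) ,
    λ { v (zero , U₀v) → suc i , U₀⊆T v U₀v
      ; v (suc j , Uv) → let (l , Tv) = cover v (j , Uv) in suc l , Tv }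
  ... | no ¬⊆ = U zero VF.∷ (λ i v → T i v × ¬ U zero v) ,
    (λ { zero → good zero
       ; (suc j) → good-∖ (good zero) (goodT j) (decidable-stable em λ ¬∃ →
           ¬⊆ (j , λ v U₀v → decidable-stable em λ ¬Tv → ¬∃ (v , U₀v , ¬Tv))) }) ,
    (λ { zero zero _ _ _ → refl
       ; zero (suc _) _ U₀v (_ , ¬U₀v) → ⊥-elim (¬U₀v U₀v)
       ; (suc _) zero _ (_ , ¬U₀v) U₀v → ⊥-elim (¬U₀v U₀v)
       ; (suc j) (suc l) v (Tj , _) (Tl , _) → cong suc (disj j l v Tj Tl) }) ,
    cover′
    where
    cover′ : ∀ v → (∃ λ i → U i v) → ∃ λ i → (U zero VF.∷ (λ i v → T i v × ¬ U zero v)) i v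
    cover′ v (i , Uv) with em {U zero v} | i | Uv
    ... | yes U₀v | _     | _  = zero , U₀v
    ... | no ¬U₀v | zero  | Uv = ⊥-elim (¬U₀v Uv)
    ... | no ¬U₀v | suc j | Uv = let (l , Tv) = cover v (j , Uv) in suc l , Tv , ¬U₀v

  -- The covering sets may reach outside `X`, as the hull of an infinite block can.
  FinitelyCovered : Subset (V G) → Set₁
  FinitelyCovered X = ∃ λ m → Σ (Fin m → Subset (V G)) λ U →
    (∀ i → Good (U i)) × (∀ v → X v → ∃ λ i → U i v)

  finitelyCovered-⋃ : ∀ {k} (X : Fin k → Subset (V G)) → (∀ j → FinitelyCovered (X j)) →
    FinitelyCovered (λ v → ∃ λ j → X j v)
  finitelyCovered-⋃ {zero} X _ = 0 , (λ ()) , (λ ()) , λ { _ (() , _) }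
  finitelyCovered-⋃ {suc k} X covered
    with (m , U , goodU , coverU) ← covered zero
    with (n , W , goodW , coverW) ← finitelyCovered-⋃ (X ∘ suc) (covered ∘ suc) =
    m + n , (λ i → [ U , W ]′ (splitAt m i)) , (λ i → good (splitAt m i)) ,
    λ { v (zero , Xv) → let (i , Uv) = coverU v Xv in
          i ↑ˡ n , subst (λ s → [ U , W ]′ s v) (sym (splitAt-↑ˡ m i n)) Uv
      ; v (suc j , Xv) → let (i , Wv) = coverW v (j , Xv) in
          m ↑ʳ i , subst (λ s → [ U , W ]′ s v) (sym (splitAt-↑ʳ m n i)) Wv }
    where
    good : ∀ s → Good ([ U , W ]′ s)
    good (inj₁ i) = goodU i
    good (inj₂ i) = goodW i

  finitelyCovered⇒lexSum : FinitelyCovered (λ _ → ⊤) → IsLexSumOfSixKinds G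
  finitelyCovered⇒lexSum (m , U , goodU , coverU)
    with (T , goodT , disj , cover) ← disjointify U goodU =
    m , D , p , lex , λ i → homogeneous⇒sixKinds (homogeneous (good i)) (loopUniform (good i))
    where
    class : ∀ v → ∃ λ i → T i v
    class v = cover v (coverU v tt)

    p : V G → Fin m
    p = proj₁ ∘ class

    good : ∀ i → Good (fiber p i)
    good i = good-resp (λ v → mk⇔ (λ Tv → disj _ _ v (proj₂ (class v)) Tv) λ { refl → proj₂ (class v) }) (goodT i)

    -- One arc between two fibers suffices: autonomy of both fibers moves its endpoints to any other
    -- pair, one endpoint at a time.
    D : FinDigraph m
    D i j = ∃ λ x → ∃ λ y → p x ≡ i × p y ≡ j × arc G x y

    lex : IsLexSum G D p
    lex x y px≢py = mk⇔ (λ xy → x , y , refl , refl , xy) λ (x' , y' , ex , ey , x'y') →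
      ⇒ (proj₂ (autonomous (good (p y)) y' y x ey refl px≢py))
        (⇒ (proj₁ (autonomous (good (p x)) x' x y' ex refl λ e → px≢py (trans (sym e) ey))) x'y')

  infinitePart-covered : ∀ {B} → IsMonomorphicPart G B → Infinite B → FinitelyCovered B
  infinitePart-covered part inf =
    1 , (λ _ → InfinitePart.Hull em G part inf) , (λ _ → InfinitePart.hull-good em G part inf) ,
    λ _ Bv → zero , inj₁ Bv

  finite-covered : ∀ {B} → Finite B → FinitelyCovered B
  finite-covered (n , f , enum) = n , (λ i → f i ≡_) , good-singleton ∘ f , enum

-- The two implications and the infinite components.

decomposition⇒lexSum : ExcludedMiddle 0ℓ → (G : Digraph) →
  (Σ ℕ λ k → Σ (V G → Fin k) λ b → IsMonomorphicDecomposition G b) → IsLexSumOfSixKinds G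
decomposition⇒lexSum em G (k , b , dec) =
  let (m , U , good , cover) = finitelyCovered-⋃ (fiber b) block-covered in
  finitelyCovered⇒lexSum (m , U , good , λ v _ → cover v (b v , refl))
  where
  open Covers em G
  block-covered : ∀ j → FinitelyCovered (fiber b j)
  block-covered j with em {Finite (fiber b j)}
  ... | yes fin = finite-covered fin
  ... | no inf  = infinitePart-covered (Blocks.block-isMonomorphicPart em G b dec j) inf

lexSum⇒decomposition : ExcludedMiddle 0ℓ → (G : Digraph) → IsLexSumOfSixKinds G →
  Σ ℕ λ k → Σ (V G → Fin k) λ b → IsMonomorphicDecomposition G b
lexSum⇒decomposition em G (m , D , p , lex , kinds)
  with (k , b , e , surj , e∘b , e-inj) ← surjective-factor em p =
  k , b , LexSum.surjective⇒decomposition em G (λ i j → D (e i) (e j)) b lex′ kinds′ surj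
  where
  open Kinds em G
  lex′ : IsLexSum G (λ i j → D (e i) (e j)) b
  lex′ x y bx≢by rewrite e∘b x | e∘b y =
    lex x y λ px≡py → bx≢by (e-inj (trans (e∘b x) (trans px≡py (sym (e∘b y)))))

  kinds′ : ∀ i → Homogeneous (fiber b i) × LoopUniform (fiber b i)
  kinds′ i = let (h , l) = sixKinds⇒homogeneous (kinds (e i)) in
    homogeneous-⊆ sub h , loopUniform-⊆ sub l
    where
    sub : ∀ v → b v ≡ i → p v ≡ e i
    sub v refl = sym (e∘b v)

-- Fibers are monomorphic parts, and an infinite part stays inside one fiber because its hull does.
-- Maximality then turns an infinite component into a whole fiber, and no part can properly extend
-- an infinite fiber.
infiniteComponents : ExcludedMiddle 0ℓ → (G : Digraph) →
  ∀ (m : ℕ) (D : FinDigraph m) (p : V G → Fin m) →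
  IsLexSum G D p → (∀ i → OfSixKinds G (fiber p i)) →
  (∀ i → ∃ λ v → p v ≡ i) →
  NoTwoElementAutonomous D →
  ∀ (X : Subset (V G)) →
  (IsMonomorphicComponent G X × Infinite X) ⇔
  (∃ λ i → (∀ v → X v ⇔ fiber p i v) × Infinite (fiber p i))
infiniteComponents em G m D p lex kinds surj prime X = mk⇔ component⇒fiber fiber⇒component
  where
  open Kinds em G
  open LexSum em G D p lex

  fiber-part : ∀ i → IsMonomorphicPart G (fiber p i)
  fiber-part = Blocks.block-isMonomorphicPart em G p
    (surjective⇒decomposition (sixKinds⇒homogeneous ∘ kinds) surj)

  part⊆fiber : ∀ {C} → IsMonomorphicPart G C → Infinite C → ∀ x y → C x → C y → p x ≡ p y
  part⊆fiber part inf x y Cx Cy =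
    good⊆fiber surj prime (InfinitePart.hull-good em G part inf) x y (inj₁ Cx) (inj₁ Cy)

  infinite-⊆ : {S T : Subset (V G)} → (∀ v → S v → T v) → Infinite S → Infinite T
  infinite-⊆ S⊆T inf (n , f , enum) = inf (n , f , λ v Sv → enum v (S⊆T v Sv))

  component⇒fiber : IsMonomorphicComponent G X × Infinite X →
    ∃ λ i → (∀ v → X v ⇔ fiber p i v) × Infinite (fiber p i)
  component⇒fiber ((part , maximal) , inf) =
    let (x , Xx , _) = InfinitePart.fresh em G part inf []
        X⊆ = λ v Xv → part⊆fiber part inf v x Xv Xx
    in p x , (λ v → mk⇔ (X⊆ v) (maximal (fiber p (p x)) (fiber-part (p x)) X⊆ v)) , infinite-⊆ X⊆ inf

  fiber⇒component : (∃ λ i → (∀ v → X v ⇔ fiber p i v) × Infinite (fiber p i)) →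
    IsMonomorphicComponent G X × Infinite X
  fiber⇒component (i , X⇔ , inf) =
    ((λ n a a' inj inj' out → fiber-part i n a a' inj inj' λ v → mk⇔
        (λ (v∈ , ∉) → let (v∈' , ∉') = ⇒ (out v) (v∈ , ∉ ∘ ⇒ (X⇔ v)) in v∈' , ∉' ∘ ⇐ (X⇔ v))
        (λ (v∈ , ∉) → let (v∈' , ∉') = ⇐ (out v) (v∈ , ∉ ∘ ⇒ (X⇔ v)) in v∈' , ∉' ∘ ⇐ (X⇔ v))) ,
     λ C partC X⊆C v Cv →
       let (x , px) = surj i in
       ⇐ (X⇔ v) (trans (part⊆fiber partC (infinite-⊆ (λ u pu → X⊆C u (⇐ (X⇔ u) pu)) inf) v x Cv
                          (X⊆C x (⇐ (X⇔ x) px))) px)) ,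
    infinite-⊆ (λ v → ⇐ (X⇔ v)) inf

mainTheorem5 : ExcludedMiddle 0ℓ → (G : Digraph) →
    ((Σ ℕ λ k → Σ (V G → Fin k) λ b → IsMonomorphicDecomposition G b) → IsLexSumOfSixKinds G)
    × (IsLexSumOfSixKinds G → Σ ℕ λ k → Σ (V G → Fin k) λ b → IsMonomorphicDecomposition G b)
    × (∀ (m : ℕ) (D : FinDigraph m) (p : V G → Fin m) →
    IsLexSum G D p → (∀ i → OfSixKinds G (fiber p i)) →
    (∀ i → ∃ λ v → p v ≡ i) →
    NoTwoElementAutonomous D →
    ∀ (X : Subset (V G)) →
    (IsMonomorphicComponent G X × Infinite X) ⇔
    (∃ λ i → (∀ v → X v ⇔ fiber p i v) × Infinite (fiber p i)))
mainTheorem5 em G = decomposition⇒lexSum em G , lexSum⇒decomposition em G , infiniteComponents em G
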